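{- Let $G$ be a connected subcubic graph with $m(G)$ edges that is not isomorphic to $K_4^+$ and not isomorphic to $K_{3,3}$. Then $\nu_{ac}(G) \geq m(G)/6$.
   Context: All graphs are finite, simple, and undirected. A graph is subcubic if its maximum degree is at most $3$. A matching $M$ in a graph $G$ is acyclic if the subgraph of $G$ induced by the set of vertices incident to some edge of $M$ is a forest; the acyclic matching number $\nu_{ac}(G)$ is the maximum size of an acyclic matching in $G$. $m(G)$ denotes the number of edges of $G$. $K_4^+$ denotes the graph obtained from the complete graph $K_4$ by subdividing one edge once (i.e., replacing one edge by a path of length $2$ through a new vertex). -}

module Defs where

open import Data.Nat using (ℕ; zero; suc; _+_; _*_; _≤_; _<_)
open import Data.Bool using (Bool; true; false; T)
open import Data.Fin using (Fin) renaming (_<_ to _<ᶠ_)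
open import Data.Fin.Properties using (_<?_)
open import Data.List using (List; []; _∷_; length; filter; allFin; concatMap; map; cartesianProduct; last; head)
open import Data.List.Relation.Unary.All using (All)
open import Data.List.Relation.Unary.Unique.Propositional using (Unique)
open import Data.List.Membership.Propositional using (_∈_)
open import Data.Product using (Σ; _×_; _,_; proj₁; proj₂; ∃)
open import Data.Maybe using (Maybe; just; nothing)
open import Relation.Nullary using (¬_)
open import Relation.Nullary.Decidable using (⌊_⌋; does)
open import Relation.Binary.PropositionalEquality using (_≡_)

record Graph : Set where
  field
    n    : ℕ
    adj  : Fin n → Fin n → Bool
    sym  : ∀ u v → adj u v ≡ adj v u
    irr  : ∀ v → adj v v ≡ false
open Graph public

Adj : (G : Graph) → Fin (n G) → Fin (n G) → Set
Adj G u v = T (adj G u v)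

degree : (G : Graph) → Fin (n G) → ℕ
degree G v = length (filter (λ u → T? (adj G v u)) (allFin (n G)))
  where
  open import Data.Bool.Properties using (T?)

Subcubic : Graph → Set
Subcubic G = ∀ v → degree G v ≤ 3

edges : (G : Graph) → List (Fin (n G) × Fin (n G))
edges G = filter (λ p → T? (does (proj₁ p <? proj₂ p) Data.Bool.∧ adj G (proj₁ p) (proj₂ p)))
                 (cartesianProduct (allFin (n G)) (allFin (n G)))
  where
  open import Data.Bool.Properties using (T?)
  import Data.Bool

m : Graph → ℕ
m G = length (edges G)

data Walk (G : Graph) : Fin (n G) → Fin (n G) → Set where
  here : ∀ {u} → Walk G u u
  step : ∀ {u v w} → Adj G u v → Walk G v w → Walk G u w

Connected : Graph → Set
Connected G = ∀ u v → Walk G u v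

data Chain (G : Graph) : List (Fin (n G)) → Set where
  []  : Chain G []
  [_] : ∀ v → Chain G (v ∷ [])
  _∷_ : ∀ {u v vs} → Adj G u v → Chain G (v ∷ vs) → Chain G (u ∷ v ∷ vs)

record Cycle (G : Graph) (vs : List (Fin (n G))) : Set where
  field
    long    : 3 ≤ length vs
    distinct : Unique vs
    chain   : Chain G vs
    closing : ∃ λ a → ∃ λ b → head vs ≡ just a × last vs ≡ just b × Adj G b a

InducedForest : (G : Graph) → List (Fin (n G)) → Set
InducedForest G S = ∀ vs → All (_∈ S) vs → ¬ Cycle G vs

covered : ∀ {k} → List (Fin k × Fin k) → List (Fin k)
covered M = concatMap (λ e → proj₁ e ∷ proj₂ e ∷ []) M

IsMatching : (G : Graph) → List (Fin (n G) × Fin (n G)) → Set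
IsMatching G M = All (λ e → Adj G (proj₁ e) (proj₂ e)) M × Unique (covered M)

IsAcyclicMatching : (G : Graph) → List (Fin (n G) × Fin (n G)) → Set
IsAcyclicMatching G M = IsMatching G M × InducedForest G (covered M)

record _≅_ (G H : Graph) : Set where
  field
    to      : Fin (n G) → Fin (n H)
    from    : Fin (n H) → Fin (n G)
    from-to : ∀ v → from (to v) ≡ v
    to-from : ∀ w → to (from w) ≡ w
    pres    : ∀ u v → adj H (to u) (to v) ≡ adj G u v

-- K4+ : K4 on {0,1,2,3} with edge 01 subdivided by vertex 4
open import Data.Fin using (zero; suc)
k4+adj : Fin 5 → Fin 5 → Bool
k4+adj zero zero = false
k4+adj zero (suc zero) = false
k4+adj (suc zero) zero = false
k4+adj (suc zero) (suc zero) = false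
k4+adj zero (suc (suc (suc (suc zero)))) = true
k4+adj (suc (suc (suc (suc zero)))) zero = true
k4+adj (suc zero) (suc (suc (suc (suc zero)))) = true
k4+adj (suc (suc (suc (suc zero)))) (suc zero) = true
k4+adj (suc (suc (suc (suc zero)))) _ = false
k4+adj _ (suc (suc (suc (suc zero)))) = false
k4+adj zero _ = true
k4+adj (suc zero) _ = true
k4+adj (suc (suc zero)) zero = true
k4+adj (suc (suc zero)) (suc zero) = true
k4+adj (suc (suc zero)) (suc (suc zero)) = false
k4+adj (suc (suc zero)) (suc (suc (suc zero))) = true
k4+adj (suc (suc (suc zero))) (suc (suc (suc zero))) = false
k4+adj (suc (suc (suc zero))) _ = true

K4+ : Graph
K4+ = record { n = 5 ; adj = k4+adj ; sym = s ; irr = i }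
  where
  s : ∀ u v → k4+adj u v ≡ k4+adj v u
  s zero zero = _≡_.refl
  s zero (suc zero) = _≡_.refl
  s zero (suc (suc zero)) = _≡_.refl
  s zero (suc (suc (suc zero))) = _≡_.refl
  s zero (suc (suc (suc (suc zero)))) = _≡_.refl
  s (suc zero) zero = _≡_.refl
  s (suc zero) (suc zero) = _≡_.refl
  s (suc zero) (suc (suc zero)) = _≡_.refl
  s (suc zero) (suc (suc (suc zero))) = _≡_.refl
  s (suc zero) (suc (suc (suc (suc zero)))) = _≡_.refl
  s (suc (suc zero)) zero = _≡_.refl
  s (suc (suc zero)) (suc zero) = _≡_.refl
  s (suc (suc zero)) (suc (suc zero)) = _≡_.refl
  s (suc (suc zero)) (suc (suc (suc zero))) = _≡_.refl
  s (suc (suc zero)) (suc (suc (suc (suc zero)))) = _≡_.refl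
  s (suc (suc (suc zero))) zero = _≡_.refl
  s (suc (suc (suc zero))) (suc zero) = _≡_.refl
  s (suc (suc (suc zero))) (suc (suc zero)) = _≡_.refl
  s (suc (suc (suc zero))) (suc (suc (suc zero))) = _≡_.refl
  s (suc (suc (suc zero))) (suc (suc (suc (suc zero)))) = _≡_.refl
  s (suc (suc (suc (suc zero)))) zero = _≡_.refl
  s (suc (suc (suc (suc zero)))) (suc zero) = _≡_.refl
  s (suc (suc (suc (suc zero)))) (suc (suc zero)) = _≡_.refl
  s (suc (suc (suc (suc zero)))) (suc (suc (suc zero))) = _≡_.refl
  s (suc (suc (suc (suc zero)))) (suc (suc (suc (suc zero)))) = _≡_.refl
  i : ∀ v → k4+adj v v ≡ false
  i zero = _≡_.refl
  i (suc zero) = _≡_.refl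
  i (suc (suc zero)) = _≡_.refl
  i (suc (suc (suc zero))) = _≡_.refl
  i (suc (suc (suc (suc zero)))) = _≡_.refl

open import Data.Fin using (toℕ)
open import Data.Nat using (_<ᵇ_)
open import Data.Bool using (_xor_)
side : Fin 6 → Bool
side v = toℕ v <ᵇ 3

K33 : Graph
K33 = record { n = 6 ; adj = λ u v → side u xor side v ; sym = s ; irr = i }
  where
  open import Data.Bool.Properties using (xor-comm; xor-same)
  s : ∀ u v → side u xor side v ≡ side v xor side u
  s u v = xor-comm (side u) (side v)
  i : ∀ v → side v xor side v ≡ false
  i v = xor-same (side v)

{-# OPTIONS --safe #-}
module Submission where

-- The inequality is proved in the stronger form  m + n₁ ≤ 6 ν, with n₁ the number of leaves, for every
-- subcubic graph, connected or not, without a component K33 or K4+.  Counting leaves makes a pendant K4+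
-- cost exactly 6: deleting its four vertices of degree 3 removes 7 edges and creates one leaf.  Without a
-- K4+ subgraph, deletions preserve the hypotheses, and near a leaf or near short cycles some k new
-- matching edges are paid for by deleting vertices incident to at most 6k edges.  Otherwise take an edge u
-- v, delete u, v and all their neighbours but one neighbour w of u and one neighbour x of v, and insert
-- the edge w x: a solution containing w and x survives the replacement of w x by the path w u v x, and the
-- matching gains the edge u v, or trades w x for w u and v x.  Should w x create a component K33 or K4+,
-- that whole component is deleted by hand.  In a cubic graph this costs 8 instead of 6, but there 3 ∣ m,
-- so the loss of 2 is recovered by rounding.

open import Defs
open import Data.Nat using (ℕ; zero; suc; _+_; _*_; _≤_; _<_; z≤n; s≤s)
import Data.Nat.Properties as ℕ
open import Data.Nat.Divisibility using (_∣_; divides; ∣m∣n⇒∣m+n; ∣m+n∣m⇒∣n; m∣m*n)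
open import Data.Nat.Induction using (<-rec)
open import Data.Nat.Solver using (module +-*-Solver)
open import Data.Bool using (Bool; true; false; T; if_then_else_)
open import Data.Bool.Properties using (T?; T-∧)
open import Data.Fin using (Fin) renaming (_<_ to _<ᶠ_)
open import Data.Fin.Patterns
import Data.Fin.Properties as F
open import Data.List using (List; []; _∷_; _++_; length; filter; map; allFin; cartesianProduct; concatMap; last)
import Data.List.Properties as L
open import Data.List.Membership.Propositional using (_∈_; _∉_)
open import Data.List.Membership.Propositional.Properties
  using (∈-filter⁺; ∈-filter⁻; ∈-cartesianProduct⁺; ∈-allFin; ∈-∃++; ∈-++⁺ˡ; ∈-++⁺ʳ; ∈-++⁻; ∈-map⁺; ∈-map⁻)
import Data.List.Membership.DecPropositional as DecMembership
open import Data.List.Relation.Binary.Subset.Propositional using (_⊆_)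
open import Data.List.Relation.Binary.Permutation.Propositional
  using (_↭_; ↭-refl; ↭-sym; ↭-trans; prep; ↭⇒↭ₛ) renaming (swap to ↭-swap)
open import Data.List.Relation.Binary.Permutation.Propositional.Properties using (∈-resp-↭; shift; All-resp-↭)
import Data.List.Relation.Binary.Permutation.Setoid.Properties as ↭ₛ
open import Data.List.Relation.Unary.Any using (here; there)
open import Data.List.Relation.Unary.All using (All; []; _∷_)
import Data.List.Relation.Unary.All as All
import Data.List.Relation.Unary.All.Properties as All
open import Data.List.Relation.Unary.Unique.Propositional using (Unique; []; _∷_)
import Data.List.Relation.Unary.Unique.Propositional.Properties as Unique
import Data.List.Relation.Unary.Unique.DecPropositional as DecUnique
open import Data.Maybe using (just)
open import Data.Product using (Σ; ∃; ∃₂; _×_; _,_; proj₁; proj₂; swap)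
open import Data.Product.Properties using (≡-dec)
open import Data.Sum using (_⊎_; inj₁; inj₂)
import Data.Sum as Sum
open import Data.Unit using (⊤; tt)
open import Data.Vec using (Vec; []; _∷_; lookup)
open import Data.Vec.Relation.Unary.All using () renaming ([] to []ᵛ; _∷_ to _∷ᵛ_)
open import Data.Vec.Relation.Unary.AllPairs using ([]; _∷_)
import Data.Vec.Relation.Unary.Unique.Propositional as Vec
import Data.Vec.Relation.Unary.Unique.Propositional.Properties as Vec
open import Function using (_∘_; id)
open import Function.Bundles using (Equivalence)
open import Relation.Nullary using (¬_; Dec; yes; no; contradiction)
open import Relation.Nullary.Decidable
  using (True; does; ⌊_⌋; toWitness; fromWitness; _×-dec_; _⊎-dec_; _→-dec_; ¬?; dec-true; dec-false; map′;
         decidable-stable)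
open import Relation.Binary.Definitions using (DecidableEquality; Tri; tri<; tri≈; tri>)
open import Relation.Binary.PropositionalEquality
  using (_≡_; _≢_; refl; cong; cong₂; subst; subst₂; trans; ≢-sym; setoid) renaming (sym to ≡-sym)

-- A matching edge `u v` fits on top of an arbitrary solution of the rest if `u` and `v` together
-- keep at most one outside neighbour. If `u` keeps `w` and `v` keeps `x`, the solution may already
-- join `w` to `x`, and a cycle closes. Deleting neighbours until one is left costs up to 8 edges
-- when `u` has degree 2 and `v` degree 3, and up to 11 in a cubic graph, while one matching edge
-- pays for 6. With `w x` inserted, the induction itself forbids a second connection between `w` and
-- `x` when both are used. One deletion is saved and the new edge pays back 1, which brings the
-- counts down to 5 and 8. The short cycles treated separately are those that leave no room for a
-- new edge.
--
-- Acyclicity is carried as an elimination order: gluing then checks one vertex at a time, and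
-- cycles as vertex sequences occur only in the final translation.

module _ {A : Set} where

  length-⊆ : {xs ys : List A} → Unique xs → xs ⊆ ys → length xs ≤ length ys
  length-⊆ {[]} _ _ = z≤n
  length-⊆ {x ∷ xs} (x∉xs ∷ uxs) xs⊆ys with ∈-∃++ (xs⊆ys (here refl))
  ... | as , bs , refl = begin
    suc (length xs)          ≤⟨ s≤s (length-⊆ uxs xs⊆as++bs) ⟩
    suc (length (as ++ bs))  ≡⟨ cong suc (L.length-++ as) ⟩
    suc (length as + length bs) ≡⟨ ≡-sym (ℕ.+-suc (length as) (length bs)) ⟩
    length as + length (x ∷ bs) ≡⟨ ≡-sym (L.length-++ as) ⟩
    length (as ++ x ∷ bs)    ∎
    where
    open ℕ.≤-Reasoning
    xs⊆as++bs : xs ⊆ as ++ bs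
    xs⊆as++bs {y} y∈xs with ∈-++⁻ as (xs⊆ys (there y∈xs))
    ... | inj₁ y∈as = ∈-++⁺ˡ y∈as
    ... | inj₂ (here refl) = contradiction refl (All.lookup x∉xs y∈xs)
    ... | inj₂ (there y∈bs) = ∈-++⁺ʳ as y∈bs

  ∷-unique : {x : A} {xs : List A} → x ∉ xs → Unique xs → Unique (x ∷ xs)
  ∷-unique x∉xs uxs = All.tabulate (λ y∈xs x≡y → x∉xs (subst (_∈ _) (≡-sym x≡y) y∈xs)) ∷ uxs

  head∉ : {x : A} {xs : List A} → Unique (x ∷ xs) → x ∉ xs
  head∉ (x∉xs ∷ _) x∈xs = All.lookup x∉xs x∈xs refl

  ⊆-saturated : DecidableEquality A → {xs ys : List A} → Unique xs → xs ⊆ ys →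
                length ys ≤ length xs → ys ⊆ xs
  ⊆-saturated _≟_ {xs} uxs xs⊆ys ≤l {y} y∈ys with DecMembership._∈?_ _≟_ y xs
  ... | yes y∈xs = y∈xs
  ... | no y∉xs = contradiction
    (length-⊆ (∷-unique y∉xs uxs) λ { (here refl) → y∈ys ; (there p) → xs⊆ys p })
    (ℕ.<⇒≱ (s≤s ≤l))

-- Graphs on a fixed vertex set: degrees, edge counts, leaves, order.

record SimpleGraph (N : ℕ) : Set where
  field
    edge : Fin N → Fin N → Bool
    edge-sym : ∀ u v → edge u v ≡ edge v u
    edge-irr : ∀ v → edge v v ≡ false
open SimpleGraph

⟦_⟧ : ∀ {N} → SimpleGraph N → Graph
⟦_⟧ {N} g = record { n = N ; adj = edge g ; sym = edge-sym g ; irr = edge-irr g }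

module _ {N : ℕ} where

  open DecMembership (F._≟_ {N}) using (_∈?_) public

  E : SimpleGraph N → Fin N → Fin N → Set
  E g = Adj ⟦ g ⟧

  E? : ∀ g u v → Dec (E g u v)
  E? g u v = T? (edge g u v)

  E-sym : ∀ g {u v} → E g u v → E g v u
  E-sym g {u} {v} = subst T (edge-sym g u v)

  E-irr : ∀ g {u v} → E g u v → u ≢ v
  E-irr g {u} e refl = subst T (edge-irr g u) e

  fromDec : {R : Fin N → Fin N → Set} → (∀ u v → Dec (R u v)) → (∀ {u v} → R u v → R v u) →
            (∀ {v} → ¬ R v v) → SimpleGraph N
  fromDec {R} R? R-sym R-irr = record
    { edge = λ u v → ⌊ R? u v ⌋ ; edge-sym = s ; edge-irr = i }
    where
    s : ∀ u v → ⌊ R? u v ⌋ ≡ ⌊ R? v u ⌋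
    s u v with R? u v | R? v u
    ... | yes _ | yes _ = refl
    ... | no  _ | no  _ = refl
    ... | yes p | no ¬p = contradiction (R-sym p) ¬p
    ... | no ¬p | yes p = contradiction (R-sym p) ¬p
    i : ∀ v → ⌊ R? v v ⌋ ≡ false
    i v with R? v v
    ... | yes p = contradiction p R-irr
    ... | no  _ = refl

  size : SimpleGraph N → ℕ
  size g = m ⟦ g ⟧

  deg : SimpleGraph N → Fin N → ℕ
  deg g = degree ⟦ g ⟧

  nbrs : SimpleGraph N → Fin N → List (Fin N)
  nbrs g v = filter (λ u → T? (edge g v u)) (allFin N)

  ∈-nbrs⁺ : ∀ g {u v} → E g u v → v ∈ nbrs g u
  ∈-nbrs⁺ g {u} {v} = ∈-filter⁺ (λ w → T? (edge g u w)) (∈-allFin v)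

  ∈-nbrs⁻ : ∀ g {u v} → v ∈ nbrs g u → E g u v
  ∈-nbrs⁻ g {u} = proj₂ ∘ ∈-filter⁻ (λ w → T? (edge g u w)) {xs = allFin N}

  nbrs-unique : ∀ g v → Unique (nbrs g v)
  nbrs-unique g v = Unique.filter⁺ (λ u → T? (edge g v u)) (Unique.allFin⁺ N)

  deg-≤ : ∀ g {v as} → (∀ {t} → E g v t → t ∈ as) → deg g v ≤ length as
  deg-≤ g {v} f = length-⊆ (nbrs-unique g v) (f ∘ ∈-nbrs⁻ g)

  deg-≥ : ∀ g {v as} → Unique as → All (E g v) as → length as ≤ deg g v
  deg-≥ g {v} u f = length-⊆ u (∈-nbrs⁺ g ∘ All.lookup f)

  deg-saturated : ∀ g {v as} → Unique as → All (E g v) as → deg g v ≤ length as →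
                  ∀ {t} → E g v t → t ∈ as
  deg-saturated g u f d = ⊆-saturated F._≟_ u (∈-nbrs⁺ g ∘ All.lookup f) d ∘ ∈-nbrs⁺ g

  edgeList : SimpleGraph N → List (Fin N × Fin N)
  edgeList g = edges ⟦ g ⟧

  ∈-edges⁺ : ∀ g {u v} → u <ᶠ v → E g u v → (u , v) ∈ edgeList g
  ∈-edges⁺ g {u} {v} u<v e =
    ∈-filter⁺ _ (∈-cartesianProduct⁺ (∈-allFin u) (∈-allFin v))
      (Equivalence.from T-∧ (subst T (≡-sym (dec-true (u F.<? v) u<v)) _ , e))

  ∈-edges⁻ : ∀ g {p} → p ∈ edgeList g → proj₁ p <ᶠ proj₂ p × E g (proj₁ p) (proj₂ p)
  ∈-edges⁻ g {u , v} p∈ with Equivalence.to T-∧ (proj₂ (∈-filter⁻ _ {xs = cartesianProduct (allFin N) (allFin N)} p∈))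
  ... | lt , e = decided (u F.<? v) lt , e
    where
    decided : {A : Set} (d : Dec A) → T (does d) → A
    decided (yes a) _ = a

  edges-unique : ∀ g → Unique (edgeList g)
  edges-unique g = Unique.filter⁺ _ (Unique.cartesianProduct⁺ (Unique.allFin⁺ N) (Unique.allFin⁺ N))

  -- Orientation is forgotten, so that lost edges can be named from either end; `ascending` restores
  -- the convention of `edges`.
  Listed : List (Fin N × Fin N) → Fin N → Fin N → Set
  Listed L u v = (u , v) ∈ L ⊎ (v , u) ∈ L

  Listed-mono : ∀ {L L′ u v} → L ⊆ L′ → Listed L u v → Listed L′ u v
  Listed-mono f = Sum.map f f

  ascending : Fin N × Fin N → Fin N × Fin N
  ascending (u , v) = if does (u F.<? v) then (u , v) else (v , u)

  ascending-< : ∀ {u v} → u <ᶠ v → ascending (u , v) ≡ (u , v)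
  ascending-< {u} {v} u<v rewrite dec-true (u F.<? v) u<v = refl

  ascending-> : ∀ {u v} → u <ᶠ v → ascending (v , u) ≡ (u , v)
  ascending-> {u} {v} u<v rewrite dec-false (v F.<? u) (F.<-asym u<v) = refl

  Listed⇒∈ : ∀ {L u v} → u <ᶠ v → Listed L u v → (u , v) ∈ map ascending L
  Listed⇒∈ u<v (inj₁ p) = subst (_∈ _) (ascending-< u<v) (∈-map⁺ ascending p)
  Listed⇒∈ u<v (inj₂ p) = subst (_∈ _) (ascending-> u<v) (∈-map⁺ ascending p)

  module _ {g h : SimpleGraph N} {L : List (Fin N × Fin N)}
           (lost : ∀ {u v} → E g u v → E h u v ⊎ Listed L u v) where

    private
      bound : List (Fin N × Fin N)
      bound = edgeList h ++ map ascending L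

      length-bound : length bound ≡ size h + length L
      length-bound = trans (L.length-++ (edgeList h)) (cong (size h +_) (L.length-map ascending L))

      ∈-bound : ∀ {u v} → u <ᶠ v → E h u v ⊎ Listed L u v → (u , v) ∈ bound
      ∈-bound u<v (inj₁ e) = ∈-++⁺ˡ (∈-edges⁺ h u<v e)
      ∈-bound u<v (inj₂ l) = ∈-++⁺ʳ (edgeList h) (Listed⇒∈ u<v l)

      edges⊆bound : edgeList g ⊆ bound
      edges⊆bound p∈ = ∈-bound (proj₁ (∈-edges⁻ g p∈)) (lost (proj₂ (∈-edges⁻ g p∈)))

    size-del : size g ≤ size h + length L
    size-del = subst (size g ≤_) length-bound (length-⊆ (edges-unique g) edges⊆bound)

    -- The pair `w x` is no edge of `g` but is accounted for on the right, as an edge of `h` or as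
    -- an item of `L`. This spare entry saves one edge, both when `w x` is inserted and when a
    -- deleted copy of a forbidden graph contains it.
    size-ins : ∀ {w x} → w ≢ x → ¬ E g w x → E h w x ⊎ Listed L w x → suc (size g) ≤ size h + length L
    size-ins {w} {x} w≢x w≁x h-wx = subst (suc (size g) ≤_) length-bound (aux (F.<-cmp w x))
      where
      flip′ : E h w x ⊎ Listed L w x → E h x w ⊎ Listed L x w
      flip′ = Sum.map (E-sym h) Sum.swap
      extend : ∀ {u v} → u <ᶠ v → ¬ E g u v → E h u v ⊎ Listed L u v → suc (size g) ≤ length bound
      extend u<v u≁v h-uv = length-⊆ (∷-unique (u≁v ∘ proj₂ ∘ ∈-edges⁻ g) (edges-unique g))
        λ { (here refl) → ∈-bound u<v h-uv ; (there p) → edges⊆bound p }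
      aux : Tri (w <ᶠ x) (w ≡ x) (x <ᶠ w) → suc (size g) ≤ length bound
      aux (tri< lt _ _) = extend lt w≁x h-wx
      aux (tri≈ _ eq _) = contradiction eq w≢x
      aux (tri> _ _ gt) = extend gt (w≁x ∘ E-sym g) (flip′ h-wx)

  Leaf : SimpleGraph N → Fin N → Set
  Leaf g v = deg g v ≡ 1

  Leaf? : ∀ g v → Dec (Leaf g v)
  Leaf? g v = deg g v ℕ.≟ 1

  leaves : SimpleGraph N → List (Fin N)
  leaves g = filter (Leaf? g) (allFin N)

  ∈-leaves⁺ : ∀ g {v} → Leaf g v → v ∈ leaves g
  ∈-leaves⁺ g {v} = ∈-filter⁺ (Leaf? g) (∈-allFin v)

  ∈-leaves⁻ : ∀ g {v} → v ∈ leaves g → Leaf g v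
  ∈-leaves⁻ g = proj₂ ∘ ∈-filter⁻ (Leaf? g) {xs = allFin N}

  leaves-unique : ∀ g → Unique (leaves g)
  leaves-unique g = Unique.filter⁺ (Leaf? g) (Unique.allFin⁺ N)

  leafCount : SimpleGraph N → ℕ
  leafCount g = length (leaves g)

  leafCount-≤ : ∀ g h K → (∀ {t} → Leaf g t → Leaf h t ⊎ t ∈ K) → leafCount g ≤ leafCount h + length K
  leafCount-≤ g h K f = subst (leafCount g ≤_) (L.length-++ (leaves h))
    (length-⊆ (leaves-unique g) λ p → Sum.[ ∈-++⁺ˡ ∘ ∈-leaves⁺ h , ∈-++⁺ʳ (leaves h) ]′ (f (∈-leaves⁻ g p)))

  leafCount-< : ∀ g h {z} → (∀ {t} → Leaf g t → Leaf h t) → ¬ Leaf g z → Leaf h z → leafCount g < leafCount h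
  leafCount-< g h f ¬z z = length-⊆ (∷-unique (¬z ∘ ∈-leaves⁻ g) (leaves-unique g))
    λ { (here refl) → ∈-leaves⁺ h z ; (there p) → ∈-leaves⁺ h (f (∈-leaves⁻ g p)) }

  leafCount-0 : ∀ g → (∀ t → ¬ Leaf g t) → leafCount g ≡ 0
  leafCount-0 g none with leaves g in eq
  ... | [] = refl
  ... | t ∷ _ = contradiction (∈-leaves⁻ g (subst (t ∈_) (≡-sym eq) (here refl))) (none t)

  Active : SimpleGraph N → Fin N → Set
  Active g v = ∃ (E g v)

  Active? : ∀ g v → Dec (Active g v)
  Active? g v = F.any? (E? g v)

  activeList : SimpleGraph N → List (Fin N)
  activeList g = filter (Active? g) (allFin N)

  -- The induction measure: deletion only isolates vertices, so `N` never changes and the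
  -- non-isolated vertices are counted instead.
  order : SimpleGraph N → ℕ
  order g = length (activeList g)

  order-< : ∀ g h {z} → (∀ {t} → Active h t → Active g t) → Active g z → ¬ Active h z → order h < order g
  order-< g h f z ¬z = length-⊆
    (∷-unique (¬z ∘ proj₂ ∘ ∈-filter⁻ (Active? h) {xs = allFin N}) (Unique.filter⁺ (Active? h) (Unique.allFin⁺ N)))
    λ { (here refl) → ∈-filter⁺ (Active? g) (∈-allFin _) z
      ; (there p) → ∈-filter⁺ (Active? g) (∈-allFin _) (f (proj₂ (∈-filter⁻ (Active? h) {xs = allFin N} p))) }

  -- Counting ordered adjacent pairs by rows and by unordered pairs: 3 ∣ 2m.
  3∣size : ∀ g → (∀ v → deg g v ≡ 0 ⊎ deg g v ≡ 3) → 3 ∣ size g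
  3∣size g cubic = ∣m+n∣m⇒∣n {3} {size g + size g} (subst (3 ∣_) (three (size g)) (m∣m*n (size g)))
                     (subst (3 ∣_) arcs-size (rows (allFin N)))
    where
    arc? : (p : Fin N × Fin N) → Dec (E g (proj₁ p) (proj₂ p))
    arc? p = E? g (proj₁ p) (proj₂ p)
    arcs : List (Fin N × Fin N)
    arcs = filter arc? (cartesianProduct (allFin N) (allFin N))

    three : ∀ k → 3 * k ≡ k + k + k
    three k = trans (cong (λ z → k + (k + z)) (ℕ.+-identityʳ k)) (≡-sym (ℕ.+-assoc k k k))

    row : ∀ u vs → length (filter arc? (map (u ,_) vs)) ≡ length (filter (E? g u) vs)
    row u [] = refl
    row u (v ∷ vs) with edge g u v
    ... | true  = cong suc (row u vs)
    ... | false = row u vs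

    rows : ∀ us → 3 ∣ length (filter arc? (cartesianProduct us (allFin N)))
    rows [] = divides 0 refl
    rows (u ∷ us) = subst (3 ∣_)
      (≡-sym (trans (cong length (L.filter-++ arc? (map (u ,_) (allFin N)) _)) (L.length-++ (filter arc? (map (u ,_) (allFin N))))))
      (∣m∣n⇒∣m+n (subst (3 ∣_) (≡-sym (row u (allFin N))) (3∣deg (cubic u))) (rows us))
      where
      3∣deg : deg g u ≡ 0 ⊎ deg g u ≡ 3 → 3 ∣ deg g u
      3∣deg (inj₁ d) = subst (3 ∣_) (≡-sym d) (divides 0 refl)
      3∣deg (inj₂ d) = subst (3 ∣_) (≡-sym d) (divides 1 refl)

    both : List (Fin N × Fin N)
    both = edgeList g ++ map swap (edgeList g)

    swapped : ∀ {p} → p ∈ map swap (edgeList g) → proj₂ p <ᶠ proj₁ p × E g (proj₁ p) (proj₂ p)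
    swapped p∈ with ∈-map⁻ swap p∈
    ... | q , q∈ , refl = proj₁ (∈-edges⁻ g q∈) , E-sym g (proj₂ (∈-edges⁻ g q∈))

    both-unique : Unique both
    both-unique = Unique.++⁺ (edges-unique g) (Unique.map⁺ (cong swap) (edges-unique g))
      λ (p , q) → F.<-asym (proj₁ (∈-edges⁻ g p)) (proj₁ (swapped q))

    ∈-arcs : ∀ {u v} → E g u v → (u , v) ∈ arcs
    ∈-arcs {u} {v} = ∈-filter⁺ arc? (∈-cartesianProduct⁺ (∈-allFin u) (∈-allFin v))

    arcs-unique : Unique arcs
    arcs-unique = Unique.filter⁺ arc? (Unique.cartesianProduct⁺ (Unique.allFin⁺ N) (Unique.allFin⁺ N))

    arcs⊆both : arcs ⊆ both
    arcs⊆both {u , v} p with proj₂ (∈-filter⁻ arc? {xs = cartesianProduct (allFin N) (allFin N)} p) | F.<-cmp u v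
    ... | e | tri< lt _ _ = ∈-++⁺ˡ (∈-edges⁺ g lt e)
    ... | e | tri≈ _ eq _ = contradiction eq (E-irr g e)
    ... | e | tri> _ _ gt = ∈-++⁺ʳ (edgeList g) (∈-map⁺ swap (∈-edges⁺ g gt (E-sym g e)))

    both⊆arcs : both ⊆ arcs
    both⊆arcs p with ∈-++⁻ (edgeList g) p
    ... | inj₁ q = ∈-arcs (proj₂ (∈-edges⁻ g q))
    ... | inj₂ q = ∈-arcs (proj₂ (swapped q))

    arcs-size : length arcs ≡ size g + size g
    arcs-size = trans (ℕ.≤-antisym (length-⊆ arcs-unique arcs⊆both) (length-⊆ both-unique both⊆arcs))
      (trans (L.length-++ (edgeList g)) (cong (size g +_) (L.length-map swap (edgeList g))))

-- Deletion and insertion, forests, and the lifting of solutions.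

module _ {N : ℕ} where

  -- Vertices are never removed from Fin N: deleting a vertex isolates it.
  module _ (g : SimpleGraph N) (S : List (Fin N)) where

    private
      Kept : Fin N → Fin N → Set
      Kept a b = E g a b × a ∉ S × b ∉ S
      Kept? : ∀ a b → Dec (Kept a b)
      Kept? a b = E? g a b ×-dec ¬? (a ∈? S) ×-dec ¬? (b ∈? S)

    del : SimpleGraph N
    del = fromDec Kept? (λ (e , p , q) → E-sym g e , q , p) (λ (e , _) → E-irr g e refl)

    del⁺ : ∀ {a b} → E g a b → a ∉ S → b ∉ S → E del a b
    del⁺ {a} {b} e p q = fromWitness {a? = Kept? a b} (e , p , q)

    del⁻ : ∀ {a b} → E del a b → E g a b × a ∉ S × b ∉ S
    del⁻ {a} {b} = toWitness {a? = Kept? a b}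

    del-or : ∀ {a b} → E g a b → E del a b ⊎ a ∈ S ⊎ b ∈ S
    del-or {a} {b} e = split (a ∈? S) (b ∈? S)
      where
      split : Dec (a ∈ S) → Dec (b ∈ S) → E del a b ⊎ a ∈ S ⊎ b ∈ S
      split (yes p) _ = inj₂ (inj₁ p)
      split (no _) (yes q) = inj₂ (inj₂ q)
      split (no p) (no q) = inj₁ (del⁺ e p q)

  module _ (g : SimpleGraph N) {w x : Fin N} (w≢x : w ≢ x) where

    private
      Joined : Fin N → Fin N → Set
      Joined a b = E g a b ⊎ (a ≡ w × b ≡ x) ⊎ (a ≡ x × b ≡ w)
      Joined? : ∀ a b → Dec (Joined a b)
      Joined? a b = E? g a b ⊎-dec ((a F.≟ w) ×-dec (b F.≟ x)) ⊎-dec ((a F.≟ x) ×-dec (b F.≟ w))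
      Joined-sym : ∀ {a b} → Joined a b → Joined b a
      Joined-sym (inj₁ e) = inj₁ (E-sym g e)
      Joined-sym (inj₂ (inj₁ (p , q))) = inj₂ (inj₂ (q , p))
      Joined-sym (inj₂ (inj₂ (p , q))) = inj₂ (inj₁ (q , p))
      Joined-irr : ∀ {a} → ¬ Joined a a
      Joined-irr (inj₁ e) = E-irr g e refl
      Joined-irr (inj₂ (inj₁ (refl , q))) = w≢x q
      Joined-irr (inj₂ (inj₂ (refl , q))) = w≢x (≡-sym q)

    ins : SimpleGraph N
    ins = fromDec Joined? Joined-sym Joined-irr

    ins⁺ : ∀ {a b} → E g a b ⊎ (a ≡ w × b ≡ x) ⊎ (a ≡ x × b ≡ w) → E ins a b
    ins⁺ {a} {b} = fromWitness {a? = Joined? a b}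

    ins⁻ : ∀ {a b} → E ins a b → E g a b ⊎ (a ≡ w × b ≡ x) ⊎ (a ≡ x × b ≡ w)
    ins⁻ {a} {b} = toWitness {a? = Joined? a b}

  -- An elimination order, latest vertex first.
  data Forest (g : SimpleGraph N) : List (Fin N) → Set where
    []   : Forest g []
    grow : ∀ {v vs} → v ∉ vs → (∀ {a b} → a ∈ vs → b ∈ vs → E g v a → E g v b → a ≡ b) →
           Forest g vs → Forest g (v ∷ vs)

  module _ (g : SimpleGraph N) where

    private
      last-∈ : ∀ {b : Fin N} x xs → last (x ∷ xs) ≡ just b → b ∈ x ∷ xs
      last-∈ x [] refl = here refl
      last-∈ x (y ∷ ys) eq = there (last-∈ y ys eq)

      last-++ : ∀ {b v : Fin N} xs → last (xs ++ v ∷ []) ≡ just b → b ≡ v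
      last-++ [] refl = refl
      last-++ (_ ∷ []) refl = refl
      last-++ (_ ∷ y ∷ ys) eq = last-++ (y ∷ ys) eq

      predecessor : ∀ {v} a as {bs} → Chain ⟦ g ⟧ (a ∷ as ++ v ∷ bs) → ∃ λ p → p ∈ a ∷ as × E g p v
      predecessor a [] (e ∷ _) = a , here refl , e
      predecessor a (a′ ∷ as) (_ ∷ c) with predecessor a′ as c
      ... | p , p∈ , e = p , there p∈ , e

      successor : ∀ {v} as {b bs} → Chain ⟦ g ⟧ (as ++ v ∷ b ∷ bs) → E g v b
      successor [] (e ∷ _) = e
      successor (_ ∷ []) (_ ∷ c) = successor [] c
      successor (_ ∷ a ∷ as) (_ ∷ c) = successor (a ∷ as) c

      disjoint : ∀ as {bs : List (Fin N)} {a b} → Unique (as ++ bs) → a ∈ as → b ∈ bs → a ≢ b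
      disjoint (x ∷ as) (x∉ ∷ _) (here refl) b∈ = All.lookup x∉ (∈-++⁺ʳ as b∈)
      disjoint (x ∷ as) (_ ∷ u) (there a∈) b∈ = disjoint as u a∈ b∈

      TwoNeighbours : List (Fin N) → Fin N → Set
      TwoNeighbours vs v = ∃₂ λ a b → a ≢ b × a ∈ vs × b ∈ vs × E g v a × E g v b

      -- At either end of the list one of the two neighbours comes from the closing edge, and the
      -- length of at least 3 keeps it different from the other one.
      cycle-neighbours : ∀ as {v} bs → Cycle ⟦ g ⟧ (as ++ v ∷ bs) → TwoNeighbours (as ++ v ∷ bs) v
      cycle-neighbours [] [] c with Cycle.long c
      ... | s≤s ()
      cycle-neighbours [] (_ ∷ []) c with Cycle.long c
      ... | s≤s (s≤s ())
      cycle-neighbours [] (b ∷ b′ ∷ bs) c with Cycle.chain c | Cycle.distinct c | Cycle.closing c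
      ... | e ∷ _ | _ ∷ (b∉ ∷ _) | _ , l , refl , eq , e′ =
        b , l , All.lookup b∉ l∈ , there (here refl) , there (there l∈) , e , E-sym g e′
        where
        l∈ : l ∈ b′ ∷ bs
        l∈ = last-∈ b′ bs eq
      cycle-neighbours (a ∷ as) (b ∷ bs) c with predecessor a as (Cycle.chain c)
      ... | p , p∈ , e =
        p , b , disjoint (a ∷ as) (Cycle.distinct c) p∈ (there (here refl)) , ∈-++⁺ˡ p∈ ,
        ∈-++⁺ʳ (a ∷ as) (there (here refl)) , E-sym g e , successor (a ∷ as) (Cycle.chain c)
      cycle-neighbours (_ ∷ []) [] c with Cycle.long c
      ... | s≤s (s≤s ())
      cycle-neighbours (a ∷ a′ ∷ as) {v} [] c with Cycle.chain c | Cycle.distinct c | Cycle.closing c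
      ... | _ ∷ ch | a∉ ∷ _ | _ , l , refl , eq , e′ with predecessor a′ as ch
      ... | p , p∈ , e =
        a , p , All.lookup a∉ (∈-++⁺ˡ p∈) , here refl , ∈-++⁺ˡ (there p∈) ,
        subst (λ z → E g z a) (last-++ (a ∷ a′ ∷ as) eq) e′ , E-sym g e

      cycle⇒neighbours : ∀ {vs v} → Cycle ⟦ g ⟧ vs → v ∈ vs → TwoNeighbours vs v
      cycle⇒neighbours c v∈ with ∈-∃++ v∈
      ... | as , bs , refl = cycle-neighbours as bs c

    -- The latest vertex of the order that lies on a cycle would have two different neighbours on
    -- it, both older, where the order allows at most one.
    Forest⇒acyclic : ∀ {S} → Forest g S → InducedForest ⟦ g ⟧ S
    Forest⇒acyclic [] [] _ c with Cycle.long c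
    ... | ()
    Forest⇒acyclic [] (_ ∷ _) (() ∷ _) _
    Forest⇒acyclic {v ∷ S} (grow _ unique f) vs vs⊆ c with v ∈? vs
    ... | no v∉ = Forest⇒acyclic f vs (All.tabulate older) c
      where
      older : ∀ {a} → a ∈ vs → a ∈ S
      older a∈ with All.lookup vs⊆ a∈
      ... | here refl = contradiction a∈ v∉
      ... | there p = p
    ... | yes v∈ with cycle⇒neighbours c v∈
    ... | a , b , a≢b , a∈ , b∈ , ea , eb = a≢b (unique (older a∈ ea) (older b∈ eb) ea eb)
      where
      older : ∀ {a} → a ∈ vs → E g v a → a ∈ S
      older a∈ e with All.lookup vs⊆ a∈
      ... | here refl = contradiction refl (E-irr g e)
      ... | there p = p

  -- The elimination order is kept apart from the matching and tied to it only by equality of vertex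
  -- sets: when `w x` is replaced by a path, the two are rebuilt independently and in different
  -- orders.
  record Solution (g : SimpleGraph N) : Set where
    field
      matching : List (Fin N × Fin N)
      elimination : List (Fin N)
      adjacent : All (λ e → E g (proj₁ e) (proj₂ e)) matching
      disjoint : Unique (covered matching)
      covered⊆ : covered matching ⊆ elimination
      ⊆covered : elimination ⊆ covered matching
      forest : Forest g elimination

    ν : ℕ
    ν = length matching

  open Solution public

  solution⇒matching : ∀ {g} (s : Solution g) → IsAcyclicMatching ⟦ g ⟧ (matching s)
  solution⇒matching {g} s = (adjacent s , disjoint s) ,
    λ vs vs⊆ → Forest⇒acyclic g (forest s) vs (All.map (covered⊆ s) vs⊆)

  covered-edge : ∀ {R : Fin N → Fin N → Set} {M z} → All (λ e → R (proj₁ e) (proj₂ e)) M → z ∈ covered M →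
                 ∃ λ y → R z y ⊎ R y z
  covered-edge (e ∷ _) (here refl) = _ , inj₁ e
  covered-edge (e ∷ _) (there (here refl)) = _ , inj₂ e
  covered-edge (_ ∷ es) (there (there p)) = covered-edge es p

  covered-active : ∀ {g} (s : Solution g) {z} → z ∈ covered (matching s) → Active g z
  covered-active {g} s z∈ with covered-edge (adjacent s) z∈
  ... | y , inj₁ e = y , e
  ... | y , inj₂ e = y , E-sym g e

  covered-++ : ∀ (M M′ : List (Fin N × Fin N)) → covered (M ++ M′) ≡ covered M ++ covered M′
  covered-++ [] M′ = refl
  covered-++ ((a , b) ∷ M) M′ = cong (λ z → a ∷ b ∷ z) (covered-++ M M′)

  -- To be read from the end of the list: each vertex sees at most one vertex `c` among the whole
  -- outside of `S` and the vertices attached before it. Because the whole outside is allowed, such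
  -- a list fits on top of every solution of `del g S`. Without any such neighbour, `c` is
  -- arbitrary.
  data Attached (g : SimpleGraph N) (S : List (Fin N)) : List (Fin N) → Set where
    []     : Attached g S []
    attach : ∀ {f fs} c → (∀ {t} → E g f t → t ∉ S ⊎ t ∈ fs → t ≡ c) → Attached g S fs → Attached g S (f ∷ fs)

  module _ {g : SimpleGraph N} {S : List (Fin N)} {M : List (Fin N × Fin N)}
           (adj-M : All (λ e → E g (proj₁ e) (proj₂ e)) M) (disj-M : Unique (covered M))
           (M⊆S : covered M ⊆ S) (att : Attached g S (covered M)) (s : Solution (del g S)) where

    private
      old∉S : ∀ {z} → z ∈ elimination s → z ∉ S
      old∉S z∈ = proj₁ (proj₂ (del⁻ g S (proj₂ (covered-active s (⊆covered s z∈)))))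

      old-forest : ∀ {os} → (∀ {z} → z ∈ os → z ∉ S) → Forest (del g S) os → Forest g os
      old-forest out [] = []
      old-forest out (grow v∉ u f) = grow v∉
        (λ a∈ b∈ ea eb → u a∈ b∈ (del⁺ g S ea (out (here refl)) (out (there a∈)))
                                 (del⁺ g S eb (out (here refl)) (out (there b∈))))
        (old-forest (out ∘ there) f)

      new-forest : ∀ {fs} → Unique fs → fs ⊆ S → Attached g S fs → Forest g (fs ++ elimination s)
      new-forest _ _ [] = old-forest old∉S (forest s)
      new-forest {f ∷ fs} u fs⊆S (attach c only att′) = grow
        (λ f∈ → Sum.[ head∉ u , (λ p → old∉S p (fs⊆S (here refl))) ]′ (∈-++⁻ fs f∈))
        (λ a∈ b∈ ea eb → trans (only ea (place a∈)) (≡-sym (only eb (place b∈))))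
        (new-forest (Unique-tail u) (fs⊆S ∘ there) att′)
        where
        Unique-tail : ∀ {z zs} → Unique {A = Fin N} (z ∷ zs) → Unique zs
        Unique-tail (_ ∷ u) = u
        place : ∀ {t} → t ∈ fs ++ elimination s → t ∉ S ⊎ t ∈ fs
        place t∈ = Sum.swap (Sum.map₂ old∉S (∈-++⁻ fs t∈))

    lift-del : Solution g
    lift-del = record
      { matching = M ++ matching s
      ; elimination = covered M ++ elimination s
      ; adjacent = All.++⁺ adj-M (All.map (proj₁ ∘ del⁻ g S) (adjacent s))
      ; disjoint = subst Unique (≡-sym (covered-++ M (matching s)))
          (Unique.++⁺ disj-M (disjoint s) λ (p , q) → old∉S (covered⊆ s q) (M⊆S p))
      ; covered⊆ = subst (_⊆ covered M ++ elimination s) (≡-sym (covered-++ M (matching s)))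
          (λ p → Sum.[ ∈-++⁺ˡ , ∈-++⁺ʳ (covered M) ∘ covered⊆ s ]′ (∈-++⁻ (covered M) p))
      ; ⊆covered = subst (covered M ++ elimination s ⊆_) (≡-sym (covered-++ M (matching s)))
          (λ p → Sum.[ ∈-++⁺ˡ , ∈-++⁺ʳ (covered M) ∘ ⊆covered s ]′ (∈-++⁻ (covered M) p))
      ; forest = new-forest disj-M M⊆S att
      }

    ν-lift-del : ν lift-del ≡ length M + ν s
    ν-lift-del = L.length-++ M

  -- An edge w x of h may be replaced by a path w u v x without creating cycles.
  module Subdivision {g h : SimpleGraph N} {u v w x : Fin N} (Out : Fin N → Set)
    (keep : ∀ {a b} → Out a → Out b → E g a b → E h a b) (h-wx : E h w x)
    (N-u : ∀ {a} → Out a → E g u a → a ≡ w) (N-v : ∀ {a} → Out a → E g v a → a ≡ x)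
    (u-in : ¬ Out u) (v-in : ¬ Out v) (w-out : Out w) (x-out : Out x)
    (u≢v : u ≢ v) (w≢x : w ≢ x) (w≁x : ¬ E g w x) where

    private
      Subdivided : List (Fin N) → Set
      Subdivided os = ∃ λ os′ → Forest g os′ × os′ ⊆ u ∷ v ∷ os × u ∷ v ∷ os ⊆ os′

      weaken : ∀ {os} → All Out os → Forest h os → Forest g os
      weaken _ [] = []
      weaken (out ∷ outs) (grow z∉ one f) = grow z∉
        (λ a∈ b∈ ea eb → one a∈ b∈ (keep out (All.lookup outs a∈) ea) (keep out (All.lookup outs b∈) eb))
        (weaken outs f)

      u-first : ∀ {os} → All Out os → x ∉ os → Forest g os → Forest g (v ∷ u ∷ os)
      u-first outs x∉ f = grow
        (λ { (here eq) → u≢v (≡-sym eq) ; (there p) → v-in (All.lookup outs p) })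
        (λ a∈ b∈ ea eb → trans (only-u a∈ ea) (≡-sym (only-u b∈ eb)))
        (grow (u-in ∘ All.lookup outs)
          (λ a∈ b∈ ea eb → trans (N-u (All.lookup outs a∈) ea) (≡-sym (N-u (All.lookup outs b∈) eb))) f)
        where
        only-u : ∀ {a} → a ∈ u ∷ _ → E g v a → a ≡ u
        only-u (here eq) _ = eq
        only-u (there p) e = contradiction (subst (_∈ _) (N-v (All.lookup outs p) e) p) x∉

      v-first : ∀ {os} → All Out os → w ∉ os → Forest g os → Forest g (u ∷ v ∷ os)
      v-first outs w∉ f = grow
        (λ { (here eq) → u≢v eq ; (there p) → u-in (All.lookup outs p) })
        (λ a∈ b∈ ea eb → trans (only-v a∈ ea) (≡-sym (only-v b∈ eb)))
        (grow (v-in ∘ All.lookup outs)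
          (λ a∈ b∈ ea eb → trans (N-v (All.lookup outs a∈) ea) (≡-sym (N-v (All.lookup outs b∈) eb))) f)
        where
        only-v : ∀ {a} → a ∈ v ∷ _ → E g u a → a ≡ v
        only-v (here eq) _ = eq
        only-v (there p) e = contradiction (subst (_∈ _) (N-u (All.lookup outs p) e) p) w∉

      ∈-there : ∀ {a b : Fin N} {os} → a ∈ b ∷ os → a ≢ b → a ∈ os
      ∈-there (here eq) a≢b = contradiction eq a≢b
      ∈-there (there p) _ = p

      v≁w : ¬ E g v w
      v≁w e = w≢x (N-v w-out e)

      u≁x : ¬ E g u x
      u≁x e = w≢x (≡-sym (N-u x-out e))

      -- Of `w` and `x`, the one placed later sees the other across the edge `w x` of `h`, hence no
      -- further older vertex. The vertices `u` and `v` are slipped in just below it, and in `g` it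
      -- then sees only the near end of that path. Vertices placed later still are adjacent to
      -- neither `u` nor `v`.
      both : ∀ {os} → All Out os → Forest h os → w ∈ os → x ∈ os → Subdivided os
      both {z ∷ os} (out ∷ outs) (grow z∉ one f) w∈ x∈ with z F.≟ w | z F.≟ x
      ... | yes refl | _ = w ∷ u ∷ v ∷ os ,
        grow (λ { (here refl) → u-in out ; (there (here refl)) → v-in out ; (there (there p)) → z∉ p })
          (λ a∈ b∈ ea eb → trans (only-u a∈ ea) (≡-sym (only-u b∈ eb))) (v-first outs z∉ (weaken outs f)) ,
        (λ { (here refl) → there (there (here refl)) ; (there (here refl)) → here refl
           ; (there (there (here refl))) → there (here refl) ; (there (there (there p))) → there (there (there p)) }) ,
        (λ { (here refl) → there (here refl) ; (there (here refl)) → there (there (here refl))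
           ; (there (there (here refl))) → here refl ; (there (there (there p))) → there (there (there p)) })
        where
        only-u : ∀ {a} → a ∈ u ∷ v ∷ os → E g w a → a ≡ u
        only-u (here eq) _ = eq
        only-u (there (here refl)) e = contradiction (E-sym g e) v≁w
        only-u (there (there p)) e with one p (∈-there x∈ (≢-sym w≢x)) (keep w-out (All.lookup outs p) e) h-wx
        ... | refl = contradiction e w≁x
      ... | no _ | yes refl = x ∷ v ∷ u ∷ os ,
        grow (λ { (here refl) → v-in out ; (there (here refl)) → u-in out ; (there (there p)) → z∉ p })
          (λ a∈ b∈ ea eb → trans (only-v a∈ ea) (≡-sym (only-v b∈ eb))) (u-first outs z∉ (weaken outs f)) ,
        (λ { (here refl) → there (there (here refl)) ; (there (here refl)) → there (here refl)
           ; (there (there (here refl))) → here refl ; (there (there (there p))) → there (there (there p)) }) ,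
        (λ { (here refl) → there (there (here refl)) ; (there (here refl)) → there (here refl)
           ; (there (there (here refl))) → here refl ; (there (there (there p))) → there (there (there p)) })
        where
        only-v : ∀ {a} → a ∈ v ∷ u ∷ os → E g x a → a ≡ v
        only-v (here eq) _ = eq
        only-v (there (here refl)) e = contradiction (E-sym g e) u≁x
        only-v (there (there p)) e with one p (∈-there w∈ w≢x) (keep x-out (All.lookup outs p) e) (E-sym h h-wx)
        ... | refl = contradiction (E-sym g e) w≁x
      ... | no z≢w | no z≢x with both outs f (∈-there w∈ (≢-sym z≢w)) (∈-there x∈ (≢-sym z≢x))
      ... | os′ , f′ , os′⊆ , ⊆os′ = z ∷ os′ ,
        grow z∉′ (λ a∈ b∈ ea eb → one (old a∈ ea) (old b∈ eb)
          (keep out (All.lookup outs (old a∈ ea)) ea) (keep out (All.lookup outs (old b∈ eb)) eb)) f′ ,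
        (λ { (here refl) → there (there (here refl)) ; (there p) → shift-in (os′⊆ p) }) ,
        (λ { (here refl) → there (⊆os′ (here refl)) ; (there (here refl)) → there (⊆os′ (there (here refl)))
           ; (there (there (here refl))) → here refl ; (there (there (there p))) → there (⊆os′ (there (there p))) })
        where
        z∉′ : z ∉ os′
        z∉′ p with os′⊆ p
        ... | here refl = u-in out
        ... | there (here refl) = v-in out
        ... | there (there q) = z∉ q
        old : ∀ {a} → a ∈ os′ → E g z a → a ∈ os
        old p e with os′⊆ p
        ... | here refl = contradiction (N-u out (E-sym g e)) z≢w
        ... | there (here refl) = contradiction (N-v out (E-sym g e)) z≢x
        ... | there (there q) = q
        shift-in : ∀ {a} → a ∈ u ∷ v ∷ os → a ∈ u ∷ v ∷ z ∷ os
        shift-in (here p) = here p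
        shift-in (there (here p)) = there (here p)
        shift-in (there (there p)) = there (there (there p))

    -- If `w` or `x` is absent, `u v` is a pendant path, attached through at most one of its ends.
    subdivide : ∀ {os} → All Out os → Forest h os → Subdivided os
    subdivide {os} outs f with w ∈? os | x ∈? os
    ... | yes w∈ | yes x∈ = both outs f w∈ x∈
    ... | no w∉ | _ = u ∷ v ∷ os , v-first outs w∉ (weaken outs f) , id , id
    ... | yes _ | no x∉ = v ∷ u ∷ os , u-first outs x∉ (weaken outs f) , exchange , exchange
      where
      exchange : ∀ {a b : Fin N} {os} → a ∷ b ∷ os ⊆ b ∷ a ∷ os
      exchange (here p) = there (here p)
      exchange (there (here p)) = here p
      exchange (there (there p)) = there (there p)

  module _ {g : SimpleGraph N} {u v w x : Fin N} {D : List (Fin N)} (w≢x : w ≢ x)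
    (uv : E g u v) (uw : E g u w) (vx : E g v x)
    (N-u : ∀ {t} → E g u t → t ∈ v ∷ w ∷ D) (N-v : ∀ {t} → E g v t → t ∈ u ∷ x ∷ D)
    (w∉ : w ∉ u ∷ v ∷ D) (x∉ : x ∉ u ∷ v ∷ D) (w≁x : ¬ E g w x)
    (s : Solution (ins (del g (u ∷ v ∷ D)) w≢x)) where

    private
      S : List (Fin N)
      S = u ∷ v ∷ D
      h : SimpleGraph N
      h = ins (del g S) w≢x
      os = elimination s

      edge-out : ∀ {a b} → E h a b → a ∉ S
      edge-out e with ins⁻ (del g S) w≢x e
      ... | inj₁ e′ = proj₁ (proj₂ (del⁻ g S e′))
      ... | inj₂ (inj₁ (refl , refl)) = w∉
      ... | inj₂ (inj₂ (refl , refl)) = x∉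

      out : ∀ {z} → z ∈ os → z ∉ S
      out z∈ = edge-out (proj₂ (covered-active s (⊆covered s z∈)))

      N-u′ : ∀ {a} → a ∉ S → E g u a → a ≡ w
      N-u′ a∉ e with N-u e
      ... | here refl = contradiction (there (here refl)) a∉
      ... | there (here eq) = eq
      ... | there (there p) = contradiction (there (there p)) a∉

      N-v′ : ∀ {a} → a ∉ S → E g v a → a ≡ x
      N-v′ a∉ e with N-v e
      ... | here refl = contradiction (here refl) a∉
      ... | there (here eq) = eq
      ... | there (there p) = contradiction (there (there p)) a∉

      open Subdivision {g} {h} (_∉ S) (λ p q e → ins⁺ (del g S) w≢x (inj₁ (del⁺ g S e p q)))
        (ins⁺ (del g S) w≢x (inj₂ (inj₁ (refl , refl)))) N-u′ N-v′
        (λ p → p (here refl)) (λ p → p (there (here refl))) w∉ x∉ (E-irr g uv) w≢x w≁x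

      order′ : ∃ λ os′ → Forest g os′ × os′ ⊆ u ∷ v ∷ os × u ∷ v ∷ os ⊆ os′
      order′ = subdivide (All.tabulate out) (forest s)

      Adjacent : SimpleGraph N → List (Fin N × Fin N) → Set
      Adjacent k = All (λ e → E k (proj₁ e) (proj₂ e))

      Rematched : List (Fin N × Fin N) → Set
      Rematched M = ∃ λ M′ → Adjacent g M′ × length M′ ≡ suc (length M) × covered M′ ↭ u ∷ v ∷ covered M

      genuine : ∀ M → Adjacent h M → w ∉ covered M → Adjacent g M
      genuine [] [] _ = []
      genuine ((a , b) ∷ M) (e ∷ es) w∉M with ins⁻ (del g S) w≢x e
      ... | inj₁ e′ = proj₁ (del⁻ g S e′) ∷ genuine M es (w∉M ∘ there ∘ there)
      ... | inj₂ (inj₁ (refl , _)) = contradiction (here refl) w∉M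
      ... | inj₂ (inj₂ (_ , refl)) = contradiction (there (here refl)) w∉M

      past-two : ∀ {a b : Fin N} {zs} → a ∷ b ∷ u ∷ v ∷ zs ↭ u ∷ v ∷ a ∷ b ∷ zs
      past-two {a} {b} {zs} = ↭-trans (prep a (shift u (b ∷ []) (v ∷ zs)))
        (↭-trans (↭-swap a u (shift v (b ∷ []) zs)) (prep u (↭-swap a v ↭-refl)))

      rematch : ∀ M → Adjacent h M → Unique (covered M) → Adjacent g M ⊎ Rematched M
      rematch [] [] _ = inj₁ []
      rematch ((a , b) ∷ M) (e ∷ es) (a∉ ∷ b∉ ∷ uM) with ins⁻ (del g S) w≢x e
      ... | inj₂ (inj₁ (refl , refl)) = inj₂ ((w , u) ∷ (v , x) ∷ M ,
        E-sym g uw ∷ vx ∷ genuine M es (λ p → All.lookup a∉ (there p) refl) , refl ,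
        ↭-trans (shift u (w ∷ []) _) (prep u (↭-swap w v ↭-refl)))
      ... | inj₂ (inj₂ (refl , refl)) = inj₂ ((x , v) ∷ (u , w) ∷ M ,
        E-sym g vx ∷ uw ∷ genuine M es (λ p → All.lookup b∉ p refl) , refl ,
        ↭-trans (shift u (x ∷ v ∷ []) _) (prep u (↭-swap x v ↭-refl)))
      ... | inj₁ e′ with rematch M es uM
      ... | inj₁ es′ = inj₁ (proj₁ (del⁻ g S e′) ∷ es′)
      ... | inj₂ (M′ , es′ , len , perm) = inj₂ ((a , b) ∷ M′ , proj₁ (del⁻ g S e′) ∷ es′ , cong suc len ,
        ↭-trans (prep a (prep b perm)) past-two)

      rematched : Rematched (matching s)
      rematched with rematch (matching s) (adjacent s) (disjoint s)
      ... | inj₁ es = (u , v) ∷ matching s , uv ∷ es , refl , ↭-refl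
      ... | inj₂ r = r

      M′ = proj₁ rematched
      perm = proj₂ (proj₂ (proj₂ rematched))

      unique′ : Unique (u ∷ v ∷ covered (matching s))
      unique′ = ∷-unique
        (λ { (here eq) → E-irr g uv eq ; (there p) → out (covered⊆ s p) (here refl) })
        (∷-unique (λ p → out (covered⊆ s p) (there (here refl))) (disjoint s))

      both-mono : ∀ {as bs : List (Fin N)} → as ⊆ bs → u ∷ v ∷ as ⊆ u ∷ v ∷ bs
      both-mono f (here p) = here p
      both-mono f (there (here p)) = there (here p)
      both-mono f (there (there p)) = there (there (f p))

    lift-ins : Solution g
    lift-ins = record
      { matching = M′
      ; elimination = proj₁ order′
      ; adjacent = proj₁ (proj₂ rematched)
      ; disjoint = ↭ₛ.Unique-resp-↭ (setoid (Fin N)) (↭⇒↭ₛ (↭-sym perm)) unique′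
      ; covered⊆ = proj₂ (proj₂ (proj₂ order′)) ∘ both-mono (covered⊆ s) ∘ ∈-resp-↭ perm
      ; ⊆covered = ∈-resp-↭ (↭-sym perm) ∘ both-mono (⊆covered s) ∘ proj₁ (proj₂ (proj₂ order′))
      ; forest = proj₁ (proj₂ order′)
      }

    ν-lift-ins : ν lift-ins ≡ suc (ν s)
    ν-lift-ins = proj₁ (proj₂ (proj₂ rematched))

-- Neighbourhoods in subcubic graphs and the arithmetic of one reduction.

module _ {N : ℕ} where

  record Neighbours (g : SimpleGraph N) (v : Fin N) (as : List (Fin N)) : Set where
    constructor nbhd
    field
      sound : All (E g v) as
      full  : ∀ {t} → E g v t → t ∈ as

  open Neighbours public

  Star : SimpleGraph N → Fin N → List (Fin N) → Set
  Star g v as = Neighbours g v as × Unique as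

  module _ (g : SimpleGraph N) where

    star : ∀ v → Star g v (nbrs g v)
    star v = nbhd (All.tabulate (∈-nbrs⁻ g)) (∈-nbrs⁺ g) , nbrs-unique g v

    star-deg : ∀ {v as} → Star g v as → deg g v ≡ length as
    star-deg (nb , u) = ℕ.≤-antisym (deg-≤ g (full nb)) (deg-≥ g u (sound nb))

    star-resp-↭ : ∀ {v as bs} → as ↭ bs → Star g v as → Star g v bs
    star-resp-↭ p (nb , u) = nbhd (All-resp-↭ p (sound nb)) (∈-resp-↭ p ∘ full nb) ,
      ↭ₛ.Unique-resp-↭ (setoid (Fin N)) (↭⇒↭ₛ p) u

    deg⇒active : ∀ {t d} → deg g t ≡ suc d → Active g t
    deg⇒active {t} eq with nbrs g t in eq′
    ... | a ∷ _ = a , ∈-nbrs⁻ g (subst (a ∈_) (≡-sym eq′) (here refl))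

    pull : ∀ {v a as} → Star g v as → E g v a → ∃ λ bs → Star g v (a ∷ bs)
    pull {a = a} st@(nb , _) e with ∈-∃++ (full nb e)
    ... | ys , zs , refl = ys ++ zs , star-resp-↭ (shift a ys zs) st

    pull₂ : ∀ {v a b as} → Star g v (a ∷ as) → E g v b → a ≢ b → ∃ λ bs → Star g v (a ∷ b ∷ bs)
    pull₂ {a = a} {b} st@(nb , _) e a≢b with full nb e
    ... | here refl = contradiction refl a≢b
    ... | there p with ∈-∃++ p
    ... | ys , zs , refl = ys ++ zs , star-resp-↭ (prep a (shift b ys zs)) st

    module _ (subcubic : ∀ v → deg g v ≤ 3) where

      star-≤ : ∀ {v as} → Star g v as → length as ≤ 3
      star-≤ {v} st = subst (_≤ 3) (star-deg st) (subcubic v)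

      data Star₁ (v a : Fin N) : Set where
        one   : Star g v (a ∷ []) → Star₁ v a
        two   : ∀ x → Star g v (a ∷ x ∷ []) → Star₁ v a
        three : ∀ x y → Star g v (a ∷ x ∷ y ∷ []) → Star₁ v a

      star₁ : ∀ {v a} → E g v a → Star₁ v a
      star₁ {v} e with pull (star v) e
      ... | [] , st = one st
      ... | x ∷ [] , st = two x st
      ... | x ∷ y ∷ [] , st = three x y st
      ... | _ ∷ _ ∷ _ ∷ _ , st with star-≤ st
      ... | s≤s (s≤s (s≤s ()))

      data Star₂ (v a b : Fin N) : Set where
        two   : Star g v (a ∷ b ∷ []) → Star₂ v a b
        three : ∀ x → Star g v (a ∷ b ∷ x ∷ []) → Star₂ v a b

      star₂ : ∀ {v a b} → E g v a → E g v b → a ≢ b → Star₂ v a b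
      star₂ {v} ea eb a≢b with pull₂ (proj₂ (pull (star v) ea)) eb a≢b
      ... | [] , st = two st
      ... | x ∷ [] , st = three x st
      ... | _ ∷ _ ∷ _ , st with star-≤ st
      ... | s≤s (s≤s (s≤s ()))

      -- A neighbour is repeated when the degree is below 3, so that one configuration serves all
      -- degrees; repetitions only overstate its cost.
      around₁ : ∀ {v a} → E g v a → ∃₂ λ x y → Neighbours g v (a ∷ x ∷ y ∷ [])
      around₁ {a = a} e with star₁ e
      ... | one (nbhd (p ∷ []) f , _) = a , a , nbhd (p ∷ p ∷ p ∷ []) (∈-++⁺ˡ ∘ f)
      ... | two x (nbhd (p ∷ q ∷ []) f , _) = x , x , nbhd (p ∷ q ∷ q ∷ []) (∈-++⁺ˡ ∘ f)
      ... | three x y (nb , _) = x , y , nb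

      around₂ : ∀ {v a b} → E g v a → E g v b → a ≢ b → ∃ λ x → Neighbours g v (a ∷ b ∷ x ∷ [])
      around₂ {a = a} ea eb a≢b with star₂ ea eb a≢b
      ... | two (nbhd (p ∷ q ∷ []) f , _) = a , nbhd (p ∷ q ∷ p ∷ []) (∈-++⁺ˡ ∘ f)
      ... | three x (nb , _) = x , nb

      around₃ : ∀ {v a b c} → E g v a → E g v b → E g v c → a ≢ b → a ≢ c → b ≢ c →
                Star g v (a ∷ b ∷ c ∷ [])
      around₃ {v} {a} {b} {c} ea eb ec a≢b a≢c b≢c with star₂ ea eb a≢b
      ... | two (nb , _) with full nb ec
      ... | here eq = contradiction (≡-sym eq) a≢c
      ... | there (here eq) = contradiction (≡-sym eq) b≢c
      around₃ {v} {a} {b} {c} ea eb ec a≢b a≢c b≢c | three x st@(nb , _) with full nb ec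
      ... | here eq = contradiction (≡-sym eq) a≢c
      ... | there (here eq) = contradiction (≡-sym eq) b≢c
      ... | there (there (here refl)) = st

  -- `δ` is the tolerated deficit: 2 for cubic graphs before rounding, 0 elsewhere.
  Near : ℕ → SimpleGraph N → Set
  Near δ g = Σ (Solution g) λ s → size g + leafCount g ≤ δ + 6 * ν s

  -- The balance of one reduction from `g` to `h`: `j` matching edges gained, `c` edges and `l`
  -- leaves lost.
  near : ∀ {δ g h j c l} (t : Solution g) (s : Near 0 h) → ν t ≡ j + ν (proj₁ s) →
         size g ≤ size h + c → leafCount g ≤ leafCount h + l → c + l ≤ δ + 6 * j → Near δ g
  near {δ} {g} {h} {j} {c} {l} t (s , s≤) eq size≤ leaf≤ cost = t , (begin
    size g + leafCount g                  ≤⟨ ℕ.+-mono-≤ size≤ leaf≤ ⟩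
    (size h + c) + (leafCount h + l)      ≡⟨ interchange (size h) c (leafCount h) l ⟩
    (size h + leafCount h) + (c + l)      ≤⟨ ℕ.+-mono-≤ s≤ cost ⟩
    6 * ν s + (δ + 6 * j)                 ≡⟨ collect δ j (ν s) ⟩
    δ + 6 * (j + ν s)                     ≡⟨ cong (λ z → δ + 6 * z) eq ⟨
    δ + 6 * ν t                           ∎)
    where
    open ℕ.≤-Reasoning
    open +-*-Solver
    interchange : ∀ a b c d → (a + b) + (c + d) ≡ (a + c) + (b + d)
    interchange = solve 4 (λ a b c d → (a :+ b) :+ (c :+ d) := (a :+ c) :+ (b :+ d)) refl
    collect : ∀ d j k → 6 * k + (d + 6 * j) ≡ d + 6 * (j + k)
    collect = solve 3 (λ d j k → con 6 :* k :+ (d :+ con 6 :* j) := d :+ con 6 :* (j :+ k)) refl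

-- A local configuration is given by indices: ι names vertices (an index outside the
-- rows may name any vertex, even one named elsewhere), and a row lists the
-- neighbours of a vertex to be deleted.
module Configuration {N : ℕ} (g : SimpleGraph N) {k : ℕ} (ι : Fin k → Fin N) where

  private
    open module ∈k = DecMembership (F._≟_ {k}) using () renaming (_∈?_ to _∈ᵏ?_)
    open module ∈kk = DecMembership (≡-dec (F._≟_ {k}) (F._≟_ {k})) using () renaming (_∈?_ to _∈ᵏᵏ?_)

  Row : Set
  Row = Fin k × List (Fin k)

  IsRow : Row → Set
  IsRow (i , js) = Neighbours g (ι i) (map ι js)

  domain : List Row → List (Fin k)
  domain = map proj₁

  arcs : List Row → List (Fin k × Fin k)
  arcs = concatMap (λ (i , js) → map (i ,_) js)

  fresh : List (Fin k) → List (Fin k) → List (Fin k)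
  fresh done = filter (λ j → ¬? (j ∈ᵏ? done))

  -- An edge between two deleted vertices is charged to the earlier row only, hence `done`.
  -- Coinciding names can only make the count too large.
  cost-from : List (Fin k) → List Row → ℕ
  cost-from done [] = 0
  cost-from done ((i , js) ∷ rs) = length (fresh done js) + cost-from (i ∷ done) rs

  cost : List Row → ℕ
  cost = cost-from []

  -- The index counterpart of the condition in `Attached`. An index outside the rows counts as a
  -- surviving vertex even if it names a deleted one, which errs on the safe side.
  Reachable : List Row → List (Fin k) → Fin k → Set
  Reachable rows fs j = j ∉ domain rows ⊎ j ∈ fs

  Reachable? : ∀ rows fs j → Dec (Reachable rows fs j)
  Reachable? rows fs j = ¬? (j ∈ᵏ? domain rows) ⊎-dec (j ∈ᵏ? fs)

  AttachedAt : List Row → Fin k → List (Fin k) → Set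
  AttachedAt rows f fs = All (λ r → proj₁ r ≡ f → length (filter (Reachable? rows fs) (proj₂ r)) ≤ 1) rows

  AttachedIn : List Row → List (Fin k) → Set
  AttachedIn rows [] = ⊤
  AttachedIn rows (f ∷ fs) = AttachedAt rows f fs × AttachedIn rows fs

  attachedIn? : ∀ rows fs → Dec (AttachedIn rows fs)
  attachedIn? rows [] = yes tt
  attachedIn? rows (f ∷ fs) =
    All.all? (λ r → (proj₁ r F.≟ f) →-dec (length (filter (Reachable? rows fs) (proj₂ r)) ℕ.≤? 1)) rows
    ×-dec attachedIn? rows fs

  Valid : List Row → List (Fin k × Fin k) → Set
  Valid rows M = All (_∈ arcs rows) M × Unique (covered M) × All (_∈ domain rows) (covered M) ×
                 AttachedIn rows (covered M)

  valid? : ∀ rows M → Dec (Valid rows M)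
  valid? rows M = All.all? (_∈ᵏᵏ? arcs rows) M ×-dec DecUnique.unique? F._≟_ (covered M) ×-dec
                  All.all? (_∈ᵏ? domain rows) (covered M) ×-dec attachedIn? rows (covered M)

  private
    arc : ∀ {rows} → All IsRow rows → ∀ {i j} → (i , j) ∈ arcs rows → E g (ι i) (ι j)
    arc {(i , js) ∷ rs} (r ∷ rows) p with ∈-++⁻ (map (i ,_) js) p
    ... | inj₂ q = arc rows q
    ... | inj₁ q with ∈-map⁻ (i ,_) q
    ... | j , j∈ , refl = All.lookup (sound r) (∈-map⁺ ι j∈)

    lost : List (Fin k) → List Row → List (Fin N × Fin N)
    lost done [] = []
    lost done ((i , js) ∷ rs) = map (λ j → ι i , ι j) (fresh done js) ++ lost (i ∷ done) rs

    length-lost : ∀ done rows → length (lost done rows) ≡ cost-from done rows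
    length-lost done [] = refl
    length-lost done ((i , js) ∷ rs) = trans (L.length-++ (map (λ j → ι i , ι j) (fresh done js)))
      (cong₂ _+_ (L.length-map (λ j → ι i , ι j) (fresh done js)) (length-lost (i ∷ done) rs))

    -- Scanning the rows, an edge is recorded at whichever end comes up first; if that is `t`, the
    -- edge is read backwards.
    ∈-lost : ∀ done rows → All IsRow rows → Unique (map ι (domain rows)) →
             (∀ {z} → z ∈ map ι (domain rows) → z ∉ map ι done) →
             ∀ {s t} → s ∈ map ι (domain rows) → t ∉ map ι done → E g s t → Listed (lost done rows) s t
    ∈-lost done ((i , js) ∷ rs) (r ∷ rows) u new (here refl) t∉ e = inj₁ (∈-++⁺ˡ listed)
      where
      listed : _ ∈ map (λ j → ι i , ι j) (fresh done js)
      listed with ∈-map⁻ ι (full r e)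
      ... | j , j∈ , refl = ∈-map⁺ (λ j → ι i , ι j)
        (∈-filter⁺ (λ j → ¬? (j ∈ᵏ? done)) j∈ (t∉ ∘ ∈-map⁺ ι))
    ∈-lost done ((i , js) ∷ rs) (r ∷ rows) u@(_ ∷ u′) new {s} {t} (there s∈) t∉ e with t F.≟ ι i
    ... | yes refl = Sum.swap (∈-lost done ((i , js) ∷ rs) (r ∷ rows) u new (here refl) (new (there s∈)) (E-sym g e))
    ... | no t≢ = Listed-mono (∈-++⁺ʳ (map (λ j → ι i , ι j) (fresh done js)))
      (∈-lost (i ∷ done) rs rows u′ new′ s∈ (λ { (here eq) → t≢ eq ; (there p) → t∉ p }) e)
      where
      new′ : ∀ {z} → z ∈ map ι (domain rs) → z ∉ map ι (i ∷ done)
      new′ z∈ (here refl) = head∉ u z∈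
      new′ z∈ (there p) = new (there z∈) p

    map-injective : ∀ {is} → Unique (map ι is) → ∀ {i j} → i ∈ is → j ∈ is → ι i ≡ ι j → i ≡ j
    map-injective u (here refl) (here refl) eq = refl
    map-injective (a ∷ _) (here refl) (there q) eq = contradiction eq (All.lookup a (∈-map⁺ ι q))
    map-injective (a ∷ _) (there p) (here refl) eq = contradiction (≡-sym eq) (All.lookup a (∈-map⁺ ι p))
    map-injective (_ ∷ u) (there p) (there q) eq = map-injective u p q eq

    covered-map : ∀ M → covered (map (λ (i , j) → ι i , ι j) M) ≡ map ι (covered M)
    covered-map [] = refl
    covered-map ((i , j) ∷ M) = cong (λ z → ι i ∷ ι j ∷ z) (covered-map M)

    ≤1⇒equal : ∀ {A : Set} {xs : List A} {x y} → length xs ≤ 1 → x ∈ xs → y ∈ xs → x ≡ y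
    ≤1⇒equal {xs = _ ∷ []} _ (here refl) (here refl) = refl
    ≤1⇒equal {xs = _ ∷ _ ∷ _} (s≤s ()) _ _

  module _ (δ : ℕ) (rows : List Row) (M : List (Fin k × Fin k)) where

    private
      S : List (Fin N)
      S = map ι (domain rows)
      M′ : List (Fin N × Fin N)
      M′ = map (λ (i , j) → ι i , ι j) M

    module _ (isRows : All IsRow rows) (unique : Unique S) where

      size-cost : size g ≤ size (del g S) + cost rows
      size-cost = subst (λ z → size g ≤ size (del g S) + z) (length-lost [] rows)
        (size-del {g = g} {h = del g S} kept-or-lost)
        where
        at : ∀ {s t} → s ∈ S → E g s t → Listed (lost [] rows) s t
        at s∈ e = ∈-lost [] rows isRows unique (λ _ ()) s∈ (λ ()) e
        kept-or-lost : ∀ {a b} → E g a b → E (del g S) a b ⊎ Listed (lost [] rows) a b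
        kept-or-lost e with del-or g S e
        ... | inj₁ kept = inj₁ kept
        ... | inj₂ (inj₁ a∈) = inj₂ (at a∈ e)
        ... | inj₂ (inj₂ b∈) = inj₂ (Sum.swap (at b∈ (E-sym g e)))

      private
        attached : ∀ fs → All (_∈ domain rows) fs → AttachedIn rows fs → Attached g S (map ι fs)
        attached [] _ _ = []
        attached (f ∷ fs) (f∈ ∷ fs∈) (here-ok , rest) with ∈-map⁻ proj₁ f∈
        ... | (f , js) , r∈ , refl = attach′ (filter (Reachable? rows fs) js) refl
          where
          row : IsRow (f , js)
          row = All.lookup isRows r∈
          few : length (filter (Reachable? rows fs) js) ≤ 1
          few = All.lookup here-ok r∈ refl
          reach : ∀ {t} → E g (ι f) t → t ∉ S ⊎ t ∈ map ι fs →
                  ∃ λ j → t ≡ ι j × j ∈ filter (Reachable? rows fs) js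
          reach e allowed with ∈-map⁻ ι (full row e)
          ... | j , j∈ , refl = j , refl , ∈-filter⁺ (Reachable? rows fs) j∈ (reachable allowed)
            where
            reachable : ι j ∉ S ⊎ ι j ∈ map ι fs → Reachable rows fs j
            reachable (inj₁ t∉) = inj₁ (t∉ ∘ ∈-map⁺ ι)
            reachable (inj₂ t∈) with j ∈ᵏ? domain rows
            ... | no j∉ = inj₁ j∉
            ... | yes j∈d with ∈-map⁻ ι t∈
            ... | j′ , j′∈ , eq = inj₂ (subst (_∈ fs) (≡-sym (map-injective unique j∈d (All.lookup fs∈ j′∈) eq)) j′∈)
          attach′ : ∀ cs → filter (Reachable? rows fs) js ≡ cs → Attached g S (ι f ∷ map ι fs)
          attach′ [] eq = attach (ι f) (λ e allowed → contradiction
            (subst (proj₁ (reach e allowed) ∈_) eq (proj₂ (proj₂ (reach e allowed)))) λ ()) (attached fs fs∈ rest)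
          attach′ (c ∷ cs) eq = attach (ι c) (λ e allowed → trans (proj₁ (proj₂ (reach e allowed)))
            (cong ι (≤1⇒equal few (proj₂ (proj₂ (reach e allowed))) (subst (c ∈_) (≡-sym eq) (here refl)))))
            (attached fs fs∈ rest)

      -- A leaf is lost only if it or its one neighbour is deleted, and in the latter case it occurs
      -- in the row of that neighbour. So every lost leaf has a name in the configuration, and
      -- listing the named leaves bounds the loss.
      leaf-or : ∀ {t} → Leaf g t → Leaf (del g S) t ⊎ ∃ λ j → t ≡ ι j
      leaf-or {t} leaf with deg⇒active g leaf
      ... | a , e with pull g (star g t) e
      ... | _ ∷ _ , st = contradiction (trans (≡-sym (star-deg g st)) leaf) λ ()
      ... | [] , nbhd _ f , _ with del-or g S e
      ... | inj₁ e′ = inj₁ (star-deg (del g S) (nbhd (e′ ∷ []) (f ∘ proj₁ ∘ del⁻ g S) , [] ∷ []))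
      ... | inj₂ (inj₁ t∈) = inj₂ (proj₁ (∈-map⁻ ι t∈) , proj₂ (proj₂ (∈-map⁻ ι t∈)))
      ... | inj₂ (inj₂ a∈) with ∈-map⁻ ι a∈
      ... | i , i∈ , refl with ∈-map⁻ proj₁ i∈
      ... | r , r∈ , refl with ∈-map⁻ ι (full (All.lookup isRows r∈) (E-sym g e))
      ... | j , _ , eq = inj₂ (j , eq)

      leaf-cost : (K : List (Fin N)) → (∀ j → Leaf g (ι j) → ι j ∈ K) →
                  leafCount g ≤ leafCount (del g S) + length K
      leaf-cost K listed = leafCount-≤ g (del g S) K λ leaf → Sum.map₂ (λ { (j , refl) → listed j leaf }) (leaf-or leaf)

      module _ (valid : Valid rows M) (s : Solution (del g S)) where

        private
          adjacent′ : All (λ e → E g (proj₁ e) (proj₂ e)) M′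
          adjacent′ = All.map⁺ (All.map (λ {e} → arc isRows {proj₁ e} {proj₂ e}) (proj₁ valid))

          disjoint′ : ∀ is → Unique is → All (_∈ domain rows) is → Unique (map ι is)
          disjoint′ [] _ _ = []
          disjoint′ (i ∷ is) (i∉ ∷ u) (i∈ ∷ is∈) = All.map⁺ (All.tabulate λ j∈ eq →
            All.lookup i∉ j∈ (map-injective unique i∈ (All.lookup is∈ j∈) eq)) ∷ disjoint′ is u is∈

          inside : ∀ {is} → All (_∈ domain rows) is → map ι is ⊆ S
          inside is∈ p with ∈-map⁻ ι p
          ... | i , i∈ , refl = ∈-map⁺ ι (All.lookup is∈ i∈)

        extend : Solution g
        extend = lift-del {M = M′} adjacent′
          (subst Unique (≡-sym (covered-map M)) (disjoint′ _ (proj₁ (proj₂ valid)) (proj₁ (proj₂ (proj₂ valid)))))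
          (λ p → inside (proj₁ (proj₂ (proj₂ valid))) (subst (_ ∈_) (covered-map M) p))
          (subst (Attached g S) (≡-sym (covered-map M))
            (attached _ (proj₁ (proj₂ (proj₂ valid))) (proj₂ (proj₂ (proj₂ valid)))))
          s

        ν-extend : ν extend ≡ length M + ν s
        ν-extend = trans (L.length-++ M′) (cong (_+ ν s) (L.length-map _ M))

    -- `ok` and `cheap` speak of indices only and are settled by evaluation at each use. About `g`
    -- itself there remain the rows, the distinctness of the deleted vertices, the possible leaves,
    -- and the solution of the rest.
    reduce : All IsRow rows → Unique S → (K : List (Fin N)) → (∀ j → Leaf g (ι j) → ι j ∈ K) → Near 0 (del g S) →
             {ok : True (valid? rows M)} {cheap : True (cost rows + length K ℕ.≤? δ + 6 * length M)} → Near δ g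
    reduce isRows unique K listed s {ok} {cheap} =
      near {δ = δ} {j = length M} (extend isRows unique (toWitness ok) (proj₁ s)) s
           (ν-extend isRows unique (toWitness ok) (proj₁ s))
           (size-cost isRows unique) (leaf-cost isRows unique K listed) (toWitness cheap)

-- Forbidden subgraphs and forbidden components.

any-vec? : ∀ {N} k {P : Vec (Fin N) k → Set} → (∀ xs → Dec (P xs)) → Dec (∃ P)
any-vec? zero P? = map′ (λ p → [] , p) (λ { ([] , p) → p }) (P? [])
any-vec? (suc k) P? = map′ (λ { (x , xs , p) → x ∷ xs , p }) (λ { (x ∷ xs , p) → x , xs , p })
  (F.any? λ x → any-vec? k λ xs → P? (x ∷ xs))

K33-degree : ∀ i → degree K33 i ≡ 3
K33-degree 0F = refl
K33-degree 1F = refl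
K33-degree 2F = refl
K33-degree 3F = refl
K33-degree 4F = refl
K33-degree 5F = refl

K4+-degree : ∀ i → i ≢ 4F → degree K4+ i ≡ 3
K4+-degree 0F _ = refl
K4+-degree 1F _ = refl
K4+-degree 2F _ = refl
K4+-degree 3F _ = refl
K4+-degree 4F i≢4 = contradiction refl i≢4

module _ {N : ℕ} where

  Embeds : (H : Graph) → SimpleGraph N → Vec (Fin N) (n H) → Set
  Embeds H g xs = (∀ i j → lookup xs i ≡ lookup xs j → i ≡ j) ×
                  (∀ i j → Adj H i j → E g (lookup xs i) (lookup xs j))

  embeds? : ∀ H g xs → Dec (Embeds H g xs)
  embeds? H g xs =
    F.all? (λ i → F.all? λ j → (lookup xs i F.≟ lookup xs j) →-dec (i F.≟ j)) ×-dec
    F.all? (λ i → F.all? λ j → T? (adj H i j) →-dec E? g (lookup xs i) (lookup xs j))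

  Contains : Graph → SimpleGraph N → Set
  Contains H g = ∃ (Embeds H g)

  contains? : ∀ H g → Dec (Contains H g)
  contains? H g = any-vec? (n H) (embeds? H g)

  -- The degree bound lets no edge leave the image and adds none inside it. For connected `H` the
  -- image is therefore a whole component, isomorphic to `H`.
  Component : Graph → SimpleGraph N → Set
  Component H g = ∃ λ xs → Embeds H g xs × (∀ i → deg g (lookup xs i) ≤ degree H i)

  component? : ∀ H g → Dec (Component H g)
  component? H g = any-vec? (n H) λ xs → embeds? H g xs ×-dec F.all? λ i → _ ℕ.≤? _

  Subcubic′ : SimpleGraph N → Set
  Subcubic′ g = ∀ v → deg g v ≤ 3

  record Admissible (g : SimpleGraph N) : Set where
    constructor admit
    field
      subcubic : Subcubic′ g
      no-K33 : ¬ Component K33 g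
      no-K4+ : ¬ Component K4+ g

  InductionHypothesis : SimpleGraph N → Set
  InductionHypothesis g = ∀ h → order h < order g → Admissible h → Near 0 h

  not-leaf : ∀ (g : SimpleGraph N) {v a b} → E g v a → E g v b → a ≢ b → ¬ Leaf g v
  not-leaf g ea eb a≢b leaf with subst (2 ≤_) leaf (deg-≥ g ((a≢b ∷ []) ∷ [] ∷ []) (ea ∷ eb ∷ []))
  ... | s≤s ()

  module _ {g : SimpleGraph N} where

    -- `K33` is 3-regular, so in a subcubic graph a copy has no room for further edges.
    contains⇒component-K33 : Subcubic′ g → Contains K33 g → Component K33 g
    contains⇒component-K33 sc (xs , e) = xs , e , λ i → subst (deg g (lookup xs i) ≤_) (≡-sym (K33-degree i)) (sc _)

    -- Only the vertex `4F`, of degree 2 in `K4+`, has room for an edge that leaves the copy.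
    contains⇒component-K4+ : Subcubic′ g → ∀ xs → Embeds K4+ g xs → deg g (lookup xs 4F) ≤ 2 → Component K4+ g
    contains⇒component-K4+ sc xs e d = xs , e , λ i → degrees i (i F.≟ 4F)
      where
      degrees : ∀ i → Dec (i ≡ 4F) → deg g (lookup xs i) ≤ degree K4+ i
      degrees i (yes refl) = d
      degrees i (no i≢4) = subst (deg g (lookup xs i) ≤_) (≡-sym (K4+-degree i i≢4)) (sc _)

    module _ (S : List (Fin N)) where

      deg-del : ∀ v → deg (del g S) v ≤ deg g v
      deg-del v = deg-≤ (del g S) (∈-nbrs⁺ g ∘ proj₁ ∘ del⁻ g S)

      embeds-del : ∀ {H xs} → Embeds H (del g S) xs → Embeds H g xs
      embeds-del (inj , hom) = inj , λ i j → proj₁ ∘ del⁻ g S ∘ hom i j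

      order-del : ∀ {z} → z ∈ S → Active g z → order (del g S) < order g
      order-del z∈ act = order-< g (del g S) (λ (t , e) → t , proj₁ (del⁻ g S e)) act
        λ (t , e) → proj₁ (proj₂ (del⁻ g S e)) z∈

      admissible-del : Subcubic′ g → ¬ Component K33 g → ¬ Component K4+ (del g S) → Admissible (del g S)
      admissible-del sc ¬K33 ¬K4+ = admit (λ v → ℕ.≤-trans (deg-del v) (sc v))
        (λ (xs , e , _) → ¬K33 (contains⇒component-K33 sc (xs , embeds-del {H = K33} {xs = xs} e))) ¬K4+

  -- A pendant K4+ costs 7 edges but turns its vertex 4 into a leaf.
  module Pendant (g : SimpleGraph N) (adm : Admissible g) (ih : InductionHypothesis g)
                 (xs : Vec (Fin N) 5) (emb : Embeds K4+ g xs) where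

    open Admissible adm

    private
      ι : Fin 5 → Fin N
      ι = lookup xs
      inj = proj₁ emb

      hom : ∀ i j {_ : True (T? (k4+adj i j))} → E g (ι i) (ι j)
      hom i j {p} = proj₂ emb i j (toWitness p)

      distinct : ∀ i j {_ : True (¬? (i F.≟ j))} → ι i ≢ ι j
      distinct i j {p} = toWitness p ∘ inj i j

      open Configuration g ι

      row : ∀ i a b c {_ : True (T? (k4+adj i a))} {_ : True (T? (k4+adj i b))} {_ : True (T? (k4+adj i c))}
            {_ : True (¬? (a F.≟ b))} {_ : True (¬? (a F.≟ c))} {_ : True (¬? (b F.≟ c))} →
            Neighbours g (ι i) (map ι (a ∷ b ∷ c ∷ []))
      row i a b c {p} {q} {r} {ab} {ac} {bc} = proj₁ (around₃ g subcubic (hom i a {p}) (hom i b {q}) (hom i c {r})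
        (distinct a b {ab}) (distinct a c {ac}) (distinct b c {bc}))

      rows : List Row
      rows = (0F , 2F ∷ 3F ∷ 4F ∷ []) ∷ (1F , 2F ∷ 3F ∷ 4F ∷ []) ∷ (2F , 0F ∷ 1F ∷ 3F ∷ []) ∷ (3F , 0F ∷ 1F ∷ 2F ∷ []) ∷ []
      M : List (Fin 5 × Fin 5)
      M = (2F , 3F) ∷ []
      S : List (Fin N)
      S = map ι (domain rows)

      isRows : All IsRow rows
      isRows = row 0F 2F 3F 4F ∷ row 1F 2F 3F 4F ∷ row 2F 0F 1F 3F ∷ row 3F 0F 1F 2F ∷ []

      unique : Unique S
      unique = (distinct 0F 1F ∷ distinct 0F 2F ∷ distinct 0F 3F ∷ []) ∷ (distinct 1F 2F ∷ distinct 1F 3F ∷ []) ∷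
               (distinct 2F 3F ∷ []) ∷ [] ∷ []

      no-leaf : ∀ j → ¬ Leaf g (ι j)
      no-leaf 0F = not-leaf g (hom 0F 2F) (hom 0F 3F) (distinct 2F 3F)
      no-leaf 1F = not-leaf g (hom 1F 2F) (hom 1F 3F) (distinct 2F 3F)
      no-leaf 2F = not-leaf g (hom 2F 0F) (hom 2F 1F) (distinct 0F 1F)
      no-leaf 3F = not-leaf g (hom 3F 0F) (hom 3F 1F) (distinct 0F 1F)
      no-leaf 4F = not-leaf g (hom 4F 0F) (hom 4F 1F) (distinct 0F 1F)

      survive : ∀ {t} → Leaf g t → Leaf (del g S) t
      survive leaf with leaf-or 0 rows M isRows unique leaf
      ... | inj₁ leaf′ = leaf′
      ... | inj₂ (j , refl) = contradiction leaf (no-leaf j)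

      4≁2 : ¬ E g (ι 2F) (ι 4F)
      4≁2 e with full (row 2F 0F 1F 3F) e
      ... | here eq = distinct 4F 0F eq
      ... | there (here eq) = distinct 4F 1F eq
      ... | there (there (here eq)) = distinct 4F 3F eq

      4≁3 : ¬ E g (ι 3F) (ι 4F)
      4≁3 e with full (row 3F 0F 1F 2F) e
      ... | here eq = distinct 4F 0F eq
      ... | there (here eq) = distinct 4F 1F eq
      ... | there (there (here eq)) = distinct 4F 2F eq

      4∉S : ι 4F ∉ S
      4∉S (here eq) = distinct 4F 0F eq
      4∉S (there (here eq)) = distinct 4F 1F eq
      4∉S (there (there (here eq))) = distinct 4F 2F eq
      4∉S (there (there (there (here eq)))) = distinct 4F 3F eq

      -- Vertex `4F` has a third neighbour `z`, since otherwise the copy would be a component. `z`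
      -- survives because `2F` and `3F` have their three neighbours elsewhere in the copy.
      new-leaf : Leaf (del g S) (ι 4F)
      new-leaf with star₂ g subcubic (hom 4F 0F) (hom 4F 1F) (distinct 0F 1F)
      ... | two st = contradiction
        (contains⇒component-K4+ {g = g} subcubic xs emb (subst (_≤ 2) (≡-sym (star-deg g st)) (s≤s (s≤s z≤n)))) no-K4+
      ... | three z (nbhd (_ ∷ _ ∷ e ∷ []) f , (_ ∷ 0≢z ∷ []) ∷ (1≢z ∷ []) ∷ _) =
        star-deg (del g S) (nbhd (del⁺ g S e 4∉S z∉S ∷ []) only , [] ∷ [])
        where
        z∉S : z ∉ S
        z∉S (here eq) = 0≢z (≡-sym eq)
        z∉S (there (here eq)) = 1≢z (≡-sym eq)
        z∉S (there (there (here refl))) = 4≁2 (E-sym g e)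
        z∉S (there (there (there (here refl)))) = 4≁3 (E-sym g e)
        only : ∀ {t} → E (del g S) (ι 4F) t → t ∈ z ∷ []
        only e′ with del⁻ g S e′
        ... | e″ , _ , t∉ with f e″
        ... | here refl = contradiction (here refl) t∉
        ... | there (here refl) = contradiction (there (here refl)) t∉
        ... | there (there p) = p

      -- In a component that is new, the vertex of degree 2 must have lost an edge. The only
      -- surviving vertex that lost edges is `ι 4F`, which has become a leaf.
      no-K4+-del : ¬ Component K4+ (del g S)
      no-K4+-del (ys , emb′@(inj′ , hom′) , degs) = no-K4+
        (contains⇒component-K4+ {g = g} subcubic ys (embeds-del {g = g} S {H = K4+} {xs = ys} emb′)
          (ℕ.≤-trans (deg-≤ g (∈-nbrs⁺ (del g S) ∘ kept)) (degs 4F)))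
        where
        κ : Fin 5 → Fin N
        κ = lookup ys
        κ∉S : κ 4F ∉ S
        κ∉S = proj₁ (proj₂ (del⁻ g S (hom′ 4F 0F _)))
        κ≢4 : κ 4F ≢ ι 4F
        κ≢4 eq = not-leaf (del g S) (hom′ 4F 0F _) (hom′ 4F 1F _) (λ eq′ → contradiction (inj′ 0F 1F eq′) λ ())
          (subst (Leaf (del g S)) (≡-sym eq) new-leaf)
        κ≢ι : ∀ j → κ 4F ≢ ι j
        κ≢ι 0F eq = κ∉S (here eq)
        κ≢ι 1F eq = κ∉S (there (here eq))
        κ≢ι 2F eq = κ∉S (there (there (here eq)))
        κ≢ι 3F eq = κ∉S (there (there (there (here eq))))
        κ≢ι 4F eq = κ≢4 eq
        kept : ∀ {t} → E g (κ 4F) t → E (del g S) (κ 4F) t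
        kept e with del-or g S e
        ... | inj₁ e′ = e′
        ... | inj₂ (inj₁ p) = contradiction p κ∉S
        ... | inj₂ (inj₂ p) with ∈-map⁻ ι p
        ... | i , i∈ , refl with ∈-map⁻ proj₁ i∈
        ... | r , r∈ , refl with ∈-map⁻ ι (full (All.lookup isRows r∈) (E-sym g e))
        ... | j , _ , eq = contradiction eq (κ≢ι j)

    pendant : Near 0 g
    pendant = result (ih (del g S) (order-del {g = g} S (here refl) (ι 2F , hom 0F 2F))
                     (admissible-del {g = g} S subcubic no-K33 no-K4+-del))
      where
      valid : Valid rows M
      valid = toWitness {a? = valid? rows M} _
      result : Near 0 (del g S) → Near 0 g
      result (s , s≤) = extend 0 rows M isRows unique valid s , (begin
        size g + leafCount g                    ≤⟨ ℕ.+-monoˡ-≤ (leafCount g) (size-cost 0 rows M isRows unique) ⟩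
        size (del g S) + 7 + leafCount g        ≡⟨ ℕ.+-assoc (size (del g S)) 7 (leafCount g) ⟩
        size (del g S) + (6 + suc (leafCount g)) ≤⟨ ℕ.+-monoʳ-≤ (size (del g S)) (ℕ.+-monoʳ-≤ 6
                                                    (leafCount-< g (del g S) survive (no-leaf 4F) new-leaf)) ⟩
        size (del g S) + (6 + leafCount (del g S)) ≡⟨ cong (size (del g S) +_) (ℕ.+-comm 6 _) ⟩
        size (del g S) + (leafCount (del g S) + 6) ≡⟨ ≡-sym (ℕ.+-assoc (size (del g S)) _ 6) ⟩
        size (del g S) + leafCount (del g S) + 6 ≤⟨ ℕ.+-monoˡ-≤ 6 s≤ ⟩
        6 * ν s + 6                             ≡⟨ ℕ.+-comm (6 * ν s) 6 ⟩
        6 + 6 * ν s                             ≡⟨ ≡-sym (ℕ.*-suc 6 (ν s)) ⟩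
        6 * suc (ν s)                           ≡⟨ cong (6 *_) (ν-extend 0 rows M isRows unique valid s) ⟨
        6 * ν (extend 0 rows M isRows unique valid s) ∎)
        where open ℕ.≤-Reasoning

-- Reductions at a leaf of a graph without `K4+`.

module Deletions {N : ℕ} (g : SimpleGraph N) (adm : Admissible g) (ih : InductionHypothesis g)
                 (K4+-free : ¬ Contains K4+ g) where

  open Admissible adm

  del-near : ∀ S {z} → z ∈ S → Active g z → Near 0 (del g S)
  del-near S z∈ act = ih (del g S) (order-del {g = g} S z∈ act) (admissible-del {g = g} S subcubic no-K33
    (λ (xs , e , _) → K4+-free (xs , embeds-del {g = g} S {H = K4+} {xs = xs} e)))

  leaf-star : ∀ {p w} → Leaf g p → E g p w → Star g p (w ∷ [])
  leaf-star leaf e with star₁ g subcubic e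
  ... | one st = st
  ... | two _ st = contradiction (trans (≡-sym (star-deg g st)) leaf) λ ()
  ... | three _ _ st = contradiction (trans (≡-sym (star-deg g st)) leaf) λ ()

  swap-star : ∀ {v a b c} → Star g v (a ∷ b ∷ c ∷ []) → Star g v (a ∷ c ∷ b ∷ [])
  swap-star = star-resp-↭ g (prep _ (↭-swap _ _ ↭-refl))

  LeafNeighbour : Fin N → Set
  LeafNeighbour w = ∃ λ p → E g w p × Leaf g p

  leafNeighbour? : ∀ w → Dec (LeafNeighbour w)
  leafNeighbour? w = F.any? λ p → E? g w p ×-dec Leaf? g p

  module LeafStep {u v} (leaf-u : Leaf g u) (uv : E g u v) where

    private
      N-u : Neighbours g u (v ∷ [])
      N-u = proj₁ (leaf-star leaf-u uv)

      u≢v : u ≢ v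
      u≢v = E-irr g uv

    leaf-at-leaf : Star g v (u ∷ []) → Near 0 g
    leaf-at-leaf (N-v , _) = reduce 0
      ((0F , 1F ∷ []) ∷ (1F , 0F ∷ []) ∷ []) ((0F , 1F) ∷ [])
      (N-u ∷ N-v ∷ []) ((u≢v ∷ []) ∷ [] ∷ [])
      (u ∷ v ∷ []) (λ { 0F _ → here refl ; 1F _ → there (here refl) })
      (del-near _ (here refl) (v , uv))
      where open Configuration g (lookup (u ∷ v ∷ []))

    leaf-at-two : ∀ {w} → Star g v (u ∷ w ∷ []) → Near 0 g
    leaf-at-two {w} (N-v , _) = reduce 0
      ((0F , 1F ∷ []) ∷ (1F , 0F ∷ 2F ∷ []) ∷ []) ((0F , 1F) ∷ [])
      (N-u ∷ N-v ∷ []) ((u≢v ∷ []) ∷ [] ∷ [])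
      (u ∷ v ∷ w ∷ []) (λ { 0F _ → here refl ; 1F _ → there (here refl) ; 2F _ → there (there (here refl)) })
      (del-near _ (here refl) (v , uv))
      where open Configuration g (lookup (u ∷ v ∷ w ∷ []))

    -- With the leaf `x` deleted too, `v` keeps only `w`. The bill is 3 edges and at most the 3
    -- leaves `u`, `x`, `w`.
    two-leaves : ∀ {w x} → Star g v (u ∷ x ∷ w ∷ []) → Leaf g x → Near 0 g
    two-leaves {w} {x} (N-v@(nbhd (vu ∷ vx ∷ vw ∷ []) _) , (u≢x ∷ u≢w ∷ []) ∷ (x≢w ∷ []) ∷ _) leaf-x = reduce 0
      ((0F , 1F ∷ []) ∷ (1F , 0F ∷ 2F ∷ 3F ∷ []) ∷ (2F , 1F ∷ []) ∷ []) ((0F , 1F) ∷ [])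
      (N-u ∷ N-v ∷ proj₁ (leaf-star leaf-x (E-sym g vx)) ∷ [])
      ((u≢v ∷ u≢x ∷ []) ∷ (E-irr g vx ∷ []) ∷ [] ∷ [])
      (u ∷ x ∷ w ∷ [])
      (λ { 0F _ → here refl ; 1F leaf → contradiction leaf (not-leaf g vu vx u≢x)
         ; 2F _ → there (here refl) ; 3F _ → there (there (here refl)) })
      (del-near _ (here refl) (v , uv))
      where open Configuration g (lookup (u ∷ v ∷ x ∷ w ∷ []))

    -- Deleting `w` as well leaves `v` attached to `x` alone. At most 5 edges go, and `u` is the
    -- only leaf at risk because `w` has no leaf neighbour: 5 + 1 = 6.
    one-leaf : ∀ {w x} → Star g v (u ∷ w ∷ x ∷ []) → ¬ Leaf g w → ¬ Leaf g x → ¬ LeafNeighbour w → Near 0 g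
    one-leaf {w} {x} (N-v@(nbhd (vu ∷ vw ∷ vx ∷ []) _) , (u≢w ∷ u≢x ∷ []) ∷ (w≢x ∷ []) ∷ _) ¬leaf-w ¬leaf-x none
      with around₁ g subcubic (E-sym g vw)
    ... | p , q , N-w@(nbhd (_ ∷ wp ∷ wq ∷ []) _) = reduce 0
      ((0F , 1F ∷ []) ∷ (1F , 0F ∷ 2F ∷ 3F ∷ []) ∷ (2F , 1F ∷ 4F ∷ 5F ∷ []) ∷ []) ((0F , 1F) ∷ [])
      (N-u ∷ N-v ∷ N-w ∷ []) ((u≢v ∷ u≢w ∷ []) ∷ (E-irr g vw ∷ []) ∷ [] ∷ [])
      (u ∷ [])
      (λ { 0F _ → here refl ; 1F leaf → contradiction leaf (not-leaf g vu vw u≢w)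
         ; 2F leaf → contradiction leaf ¬leaf-w ; 3F leaf → contradiction leaf ¬leaf-x
         ; 4F leaf → contradiction (p , wp , leaf) none ; 5F leaf → contradiction (q , wq , leaf) none })
      (del-near _ (here refl) (v , uv))
      where open Configuration g (lookup (u ∷ v ∷ w ∷ x ∷ p ∷ q ∷ []))

    -- Here deleting `w` or `x` would cost another leaf. Instead the path `u v w p` carries two
    -- matching edges and hangs on `w′`, with `x` deleted. The budget of 12 is met exactly: 7 edges
    -- and up to 5 leaves.
    three-leaves : ∀ {w x} → Star g v (u ∷ w ∷ x ∷ []) → ¬ Leaf g w → ¬ Leaf g x →
                   LeafNeighbour w → LeafNeighbour x → Near 0 g
    three-leaves {w} {x} (N-v@(nbhd (vu ∷ vw ∷ vx ∷ []) _) , (u≢w ∷ u≢x ∷ []) ∷ (w≢x ∷ []) ∷ _) ¬leaf-w ¬leaf-x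
                 (p , wp , leaf-p) (q , xq , leaf-q) = go
      (around₂ g subcubic (E-sym g vw) wp (v≢leaf leaf-p)) (around₂ g subcubic (E-sym g vx) xq (v≢leaf leaf-q))
      where
      ¬leaf-v : ¬ Leaf g v
      ¬leaf-v = not-leaf g vu vw u≢w
      v≢leaf : ∀ {t} → Leaf g t → v ≢ t
      v≢leaf leaf eq = ¬leaf-v (subst (Leaf g) (≡-sym eq) leaf)
      u≢p : u ≢ p
      u≢p refl with full N-u (E-sym g wp)
      ... | here eq = E-irr g vw (≡-sym eq)
      go : (∃ λ w′ → Neighbours g w (v ∷ p ∷ w′ ∷ [])) → (∃ λ x′ → Neighbours g x (v ∷ q ∷ x′ ∷ [])) → Near 0 g
      go (w′ , N-w) (x′ , N-x) = reduce 0
        ((0F , 1F ∷ []) ∷ (1F , 0F ∷ 2F ∷ 4F ∷ []) ∷ (2F , 1F ∷ 3F ∷ 5F ∷ []) ∷ (3F , 2F ∷ []) ∷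
         (4F , 1F ∷ 6F ∷ 7F ∷ []) ∷ []) ((0F , 1F) ∷ (3F , 2F) ∷ [])
        (N-u ∷ N-v ∷ N-w ∷ proj₁ (leaf-star leaf-p (E-sym g wp)) ∷ N-x ∷ [])
        ((u≢v ∷ u≢w ∷ u≢p ∷ u≢x ∷ []) ∷ (E-irr g vw ∷ v≢leaf leaf-p ∷ E-irr g vx ∷ []) ∷
         (E-irr g wp ∷ w≢x ∷ []) ∷ ((λ { refl → ¬leaf-x leaf-p }) ∷ []) ∷ [] ∷ [])
        (u ∷ p ∷ w′ ∷ q ∷ x′ ∷ [])
        (λ { 0F _ → here refl ; 1F leaf → contradiction leaf ¬leaf-v ; 2F leaf → contradiction leaf ¬leaf-w
           ; 3F _ → there (here refl) ; 4F leaf → contradiction leaf ¬leaf-x ; 5F _ → there (there (here refl))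
           ; 6F _ → there (there (there (here refl))) ; 7F _ → there (there (there (there (here refl)))) })
        (del-near _ (here refl) (v , uv))
        where open Configuration g (lookup (u ∷ v ∷ w ∷ p ∷ x ∷ w′ ∷ q ∷ x′ ∷ []))

    leaf-step : Near 0 g
    leaf-step with star₁ g subcubic (E-sym g uv)
    ... | one st = leaf-at-leaf st
    ... | two w st = leaf-at-two st
    ... | three w x st = cases (Leaf? g w) (Leaf? g x) (leafNeighbour? w) (leafNeighbour? x)
      where
      cases : Dec (Leaf g w) → Dec (Leaf g x) → Dec (LeafNeighbour w) → Dec (LeafNeighbour x) → Near 0 g
      cases (yes leaf-w) _ _ _ = two-leaves st leaf-w
      cases (no _) (yes leaf-x) _ _ = two-leaves (swap-star st) leaf-x
      cases (no ¬w) (no ¬x) (no none) _ = one-leaf st ¬w ¬x none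
      cases (no ¬w) (no ¬x) (yes _) (no none) = one-leaf (swap-star st) ¬x ¬w none
      cases (no ¬w) (no ¬x) (yes p) (yes q) = three-leaves st ¬w ¬x p q

-- Edges at a vertex set, and components that copy a fixed graph.

module _ {N : ℕ} (g : SimpleGraph N) where

  incident : List (Fin N) → List (Fin N × Fin N)
  incident = concatMap (λ d → map (d ,_) (nbrs g d))

  ∈-incident : ∀ {D d t} → d ∈ D → E g d t → (d , t) ∈ incident D
  ∈-incident (here refl) e = ∈-++⁺ˡ (∈-map⁺ (_ ,_) (∈-nbrs⁺ g e))
  ∈-incident {D = d′ ∷ D} (there p) e = ∈-++⁺ʳ (map (d′ ,_) (nbrs g d′)) (∈-incident p e)

  length-incident : Subcubic′ g → ∀ D → length (incident D) ≤ 3 * length D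
  length-incident sc [] = z≤n
  length-incident sc (d ∷ D) = begin
    length (map (d ,_) (nbrs g d) ++ incident D)          ≡⟨ L.length-++ (map (d ,_) (nbrs g d)) ⟩
    length (map (d ,_) (nbrs g d)) + length (incident D)  ≡⟨ cong (_+ length (incident D)) (L.length-map (d ,_) (nbrs g d)) ⟩
    deg g d + length (incident D)                         ≤⟨ ℕ.+-mono-≤ (sc d) (length-incident sc D) ⟩
    3 + 3 * length D                                      ≡⟨ ℕ.*-suc 3 (length D) ⟨
    3 * suc (length D)                                    ∎
    where open ℕ.≤-Reasoning

module _ (H : Graph) where

  private
    h : SimpleGraph (n H)
    h = record { edge = adj H ; edge-sym = Graph.sym H ; edge-irr = irr H }

  listed-pattern : ∀ {i j} → Adj H i j → Listed (edges H) i j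
  listed-pattern {i} {j} a with F.<-cmp i j
  ... | tri< lt _ _ = inj₁ (∈-edges⁺ h lt a)
  ... | tri≈ _ eq _ = contradiction eq (E-irr h a)
  ... | tri> _ _ gt = inj₂ (∈-edges⁺ h gt (E-sym h a))

module EmbeddedComponent {N : ℕ} (H : Graph) (h : SimpleGraph N) (xs : Vec (Fin N) (n H)) (emb : Embeds H h xs)
  (degs : ∀ i → deg h (lookup xs i) ≤ degree H i) where

  ι : Fin (n H) → Fin N
  ι = lookup xs

  inj : ∀ {i j} → ι i ≡ ι j → i ≡ j
  inj = proj₁ emb _ _

  hom : ∀ {i j} → Adj H i j → E h (ι i) (ι j)
  hom = proj₂ emb _ _

  private
    H′ : SimpleGraph (n H)
    H′ = record { edge = adj H ; edge-sym = Graph.sym H ; edge-irr = irr H }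

    around : Fin (n H) → List (Fin N)
    around i = map ι (nbrs H′ i)

    around-unique : ∀ i → Unique (around i)
    around-unique i = Unique.map⁺ inj (nbrs-unique H′ i)

    around-adj : ∀ i → All (E h (ι i)) (around i)
    around-adj i = All.map⁺ (All.tabulate (hom ∘ ∈-nbrs⁻ H′))

    length-around : ∀ i → length (around i) ≡ degree H i
    length-around i = L.length-map ι (nbrs H′ i)

  degree-≤ : ∀ i → degree H i ≤ deg h (ι i)
  degree-≤ i = subst (_≤ deg h (ι i)) (length-around i) (deg-≥ h (around-unique i) (around-adj i))

  -- The copy already supplies as many neighbours as the degree bound admits.
  closed-component : ∀ i {t} → E h (ι i) t → ∃ λ j → Adj H i j × t ≡ ι j
  closed-component i e with ∈-map⁻ ι (deg-saturated h (around-unique i) (around-adj i)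
                      (subst (deg h (ι i) ≤_) (≡-sym (length-around i)) (degs i)) e)
  ... | j , j∈ , eq = j , ∈-nbrs⁻ H′ j∈ , eq

abstract
  -- `i e c j` is a 4-cycle through `i j` with both diagonals absent. When `i j` is the inserted
  -- edge, an induced path is left in `g`, on which `i e` and `c j` form an acyclic matching.
  K33-bypass : ∀ i j → Adj K33 i j → ∃₂ λ e c → Adj K33 i e × Adj K33 e c × Adj K33 c j ×
               e ≢ j × c ≢ i × ¬ Adj K33 i c × ¬ Adj K33 e j
  K33-bypass = toWitness {a? = F.all? λ i → F.all? λ j → T? (adj K33 i j) →-dec F.any? λ e → F.any? λ c →
    T? (adj K33 i e) ×-dec T? (adj K33 e c) ×-dec T? (adj K33 c j) ×-dec
    ¬? (e F.≟ j) ×-dec ¬? (c F.≟ i) ×-dec ¬? (T? (adj K33 i c)) ×-dec ¬? (T? (adj K33 e j))} _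

  -- `a b` avoids both ends of the inserted edge, so neither `a` nor `b` is a neighbour of `u` or
  -- `v`. Since `a` is not `4F`, at most `b` can see anything outside the copy.
  K4+-disjoint : ∀ i j → Adj K4+ i j → ∃₂ λ a b → Adj K4+ a b × a ≢ 4F × a ≢ i × a ≢ j × b ≢ i × b ≢ j
  K4+-disjoint = toWitness {a? = F.all? λ i → F.all? λ j → T? (adj K4+ i j) →-dec F.any? λ a → F.any? λ b →
    T? (adj K4+ a b) ×-dec ¬? (a F.≟ 4F) ×-dec ¬? (a F.≟ i) ×-dec ¬? (a F.≟ j) ×-dec ¬? (b F.≟ i) ×-dec ¬? (b F.≟ j)} _

  K33-active : ∀ i → ∃ (Adj K33 i)
  K33-active = toWitness {a? = F.all? λ i → F.any? λ j → T? (adj K33 i j)} _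

  K4+-active : ∀ i → ∃ (Adj K4+ i)
  K4+-active = toWitness {a? = F.all? λ i → F.any? λ j → T? (adj K4+ i j)} _

-- Inserting `w x`, and removing a forbidden component that it creates.

module Insertion {N : ℕ} (g : SimpleGraph N) (adm : Admissible g) (ih : InductionHypothesis g)
  (K4+-free : ¬ Contains K4+ g) (leafless : ∀ t → ¬ Leaf g t)
  {u v w x y : Fin N} (B : List (Fin N)) (|B|≤1 : length B ≤ 1)
  (uv : E g u v) (uw : E g u w) (N-u : ∀ {t} → E g u t → t ∈ v ∷ w ∷ B)
  (star-v : Neighbours g v (u ∷ x ∷ y ∷ []))
  (u∉D : u ∉ y ∷ B) (v∉D : v ∉ y ∷ B) (w∉S : w ∉ u ∷ v ∷ y ∷ B) (x∉S : x ∉ u ∷ v ∷ y ∷ B)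
  (w≢x : w ≢ x) (w≁x : ¬ E g w x) where

  open Admissible adm
  open Deletions g adm ih K4+-free using (del-near)

  private
    D S : List (Fin N)
    D = y ∷ B
    S = u ∷ v ∷ D

    h : SimpleGraph N
    h = ins (del g S) w≢x

    N-v : ∀ {t} → E g v t → t ∈ u ∷ x ∷ y ∷ []
    N-v = full star-v

    vx : E g v x
    vx = All.lookup (sound star-v) (there (here refl))

    kept : ∀ {a b} → E g a b → a ∉ S → b ∉ S → E h a b
    kept e p q = ins⁺ (del g S) w≢x (inj₁ (del⁺ g S e p q))

    h-wx : E h w x
    h-wx = ins⁺ (del g S) w≢x (inj₂ (inj₁ (refl , refl)))

    edge-h : ∀ {a b} → E h a b → (E g a b × a ∉ S × b ∉ S) ⊎ (a ≡ w × b ≡ x) ⊎ (a ≡ x × b ≡ w)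
    edge-h e = Sum.map₁ (del⁻ g S) (ins⁻ (del g S) w≢x e)

    out : ∀ {a b} → E h a b → a ∉ S
    out e with edge-h e
    ... | inj₁ (_ , a∉ , _) = a∉
    ... | inj₂ (inj₁ (refl , _)) = w∉S
    ... | inj₂ (inj₂ (refl , _)) = x∉S

    order-h : order h < order g
    order-h = order-< g h active (v , uv) λ (_ , e) → out e (here refl)
      where
      active : ∀ {t} → Active h t → Active g t
      active (t , e) with edge-h e
      ... | inj₁ (e′ , _) = t , e′
      ... | inj₂ (inj₁ (refl , _)) = u , E-sym g uw
      ... | inj₂ (inj₂ (refl , _)) = v , E-sym g vx

    -- Insertion raises no degree, because `w` and `x` each lose a neighbour in exchange, and every
    -- neighbour in `D` is a further loss. With `ds` empty this keeps `h` subcubic; with one element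
    -- it shows that degree 3 in `h` excludes neighbours in `D`.
    deg-drop : ∀ ds {t} → Unique ds → All (_∈ D) ds → All (E g t) ds → length ds + deg h t ≤ deg g t
    deg-drop ds {t} uds ds⊆D adj-ds = by-cases (t F.≟ w) (t F.≟ x)
      where
      ds⊆S : ∀ {d} → d ∈ ds → d ∈ S
      ds⊆S = there ∘ there ∘ All.lookup ds⊆D
      nbrs-out : ∀ {d} → d ∈ nbrs h t → d ∉ S
      nbrs-out p = out (E-sym h (∈-nbrs⁻ h p))
      unique-both : Unique (ds ++ nbrs h t)
      unique-both = Unique.++⁺ uds (nbrs-unique h t) λ (p , q) → nbrs-out q (ds⊆S p)
      length-both : length (ds ++ nbrs h t) ≡ length ds + deg h t
      length-both = L.length-++ ds
      ordinary : t ≢ w → t ≢ x → ∀ {d} → E h t d → E g t d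
      ordinary t≢w t≢x e with edge-h e
      ... | inj₁ (e′ , _) = e′
      ... | inj₂ (inj₁ (eq , _)) = contradiction eq t≢w
      ... | inj₂ (inj₂ (eq , _)) = contradiction eq t≢x
      -- An end of the new edge trades its neighbour s ∈ {u , v} for the other end z.
      trade : ∀ s z → E g t s → s ∉ D → s ∈ S → (∀ {d} → E h t d → d ≡ z ⊎ E g t d) → length ds + deg h t ≤ deg g t
      trade s z ts s∉D s∈S sub = ℕ.≤-pred (subst (λ k → suc k ≤ suc (deg g t)) length-both
        (length-⊆ {xs = s ∷ ds ++ nbrs h t} {ys = z ∷ nbrs g t}
          (∷-unique (λ p → Sum.[ s∉D ∘ All.lookup ds⊆D , (λ q → nbrs-out q s∈S) ]′ (∈-++⁻ ds p)) unique-both)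
          λ { (here refl) → there (∈-nbrs⁺ g ts)
            ; (there p) → Sum.[ (λ q → there (∈-nbrs⁺ g (All.lookup adj-ds q)))
                              , (λ q → Sum.[ here , there ∘ ∈-nbrs⁺ g ]′ (sub (∈-nbrs⁻ h q))) ]′ (∈-++⁻ ds p) }))
      by-cases : Dec (t ≡ w) → Dec (t ≡ x) → length ds + deg h t ≤ deg g t
      by-cases (no t≢w) (no t≢x) = subst (_≤ deg g t) length-both (length-⊆ unique-both
        λ p → Sum.[ ∈-nbrs⁺ g ∘ All.lookup adj-ds , ∈-nbrs⁺ g ∘ ordinary t≢w t≢x ∘ ∈-nbrs⁻ h ]′ (∈-++⁻ ds p))
      by-cases (yes refl) _ = trade u x (E-sym g uw) u∉D (here refl) sub
        where
        sub : ∀ {d} → E h w d → d ≡ x ⊎ E g w d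
        sub e with edge-h e
        ... | inj₁ (e′ , _) = inj₂ e′
        ... | inj₂ (inj₁ (_ , eq)) = inj₁ eq
        ... | inj₂ (inj₂ (eq , _)) = contradiction eq w≢x
      by-cases (no _) (yes refl) = trade v w (E-sym g vx) v∉D (there (here refl)) sub
        where
        sub : ∀ {d} → E h x d → d ≡ w ⊎ E g x d
        sub e with edge-h e
        ... | inj₁ (e′ , _) = inj₂ e′
        ... | inj₂ (inj₁ (eq , _)) = contradiction (≡-sym eq) w≢x
        ... | inj₂ (inj₂ (_ , eq)) = inj₁ eq

    subcubic-h : Subcubic′ h
    subcubic-h t = ℕ.≤-trans (deg-drop [] [] [] []) (subcubic t)

    no-leaves : ∀ (h′ : SimpleGraph N) → leafCount g ≤ leafCount h′ + 0
    no-leaves h′ = subst (_≤ leafCount h′ + 0) (≡-sym (leafCount-0 g leafless)) z≤n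

    path : List (Fin N × Fin N)
    path = (u , v) ∷ (u , w) ∷ (v , x) ∷ []

    listed-u : ∀ {L t} → Listed L u v → Listed L u w → (∀ {b} → b ∈ B → E g u b → Listed L u b) → E g u t → Listed L u t
    listed-u lv lw lB e with N-u e
    ... | here refl = lv
    ... | there (here refl) = lw
    ... | there (there p) = lB p e

    listed-v : ∀ {L t} → Listed L v u → Listed L v x → Listed L v y → E g v t → Listed L v t
    listed-v lu lx ly e with N-v e
    ... | here refl = lu
    ... | there (here refl) = lx
    ... | there (there (here refl)) = ly

    -- The lost edges are among the three of `path` and those at `D`; the inserted edge `w x` is the
    -- spare entry behind the `suc`.
    size-h : suc (size g) ≤ size h + length (path ++ incident g D)
    size-h = size-ins {g = g} {h = h} lost w≢x w≁x (inj₁ h-wx)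
      where
      L = path ++ incident g D
      in-path : ∀ {a b} → (a , b) ∈ path → (a , b) ∈ L
      in-path p = ∈-++⁺ˡ {ys = incident g D} p
      at-D : ∀ {a b} → a ∈ D → E g a b → (a , b) ∈ L
      at-D a∈ e = ∈-++⁺ʳ path (∈-incident g a∈ e)
      at : ∀ {a b} → a ∈ S → E g a b → Listed L a b
      at (here refl) = listed-u {L} (inj₁ (in-path (here refl))) (inj₁ (in-path (there (here refl))))
        (λ p e → inj₂ (at-D (there p) (E-sym g e)))
      at (there (here refl)) = listed-v {L} (inj₂ (in-path (here refl))) (inj₁ (in-path (there (there (here refl)))))
        (inj₂ (at-D (here refl) (E-sym g (All.lookup (sound star-v) (there (there (here refl)))))))
      at (there (there a∈)) e = inj₁ (at-D a∈ e)
      lost : ∀ {a b} → E g a b → E h a b ⊎ Listed L a b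
      lost e with del-or g S e
      ... | inj₁ e′ = inj₁ (ins⁺ (del g S) w≢x (inj₁ e′))
      ... | inj₂ (inj₁ a∈) = inj₂ (at a∈ e)
      ... | inj₂ (inj₂ b∈) = inj₂ (Sum.swap (at b∈ (E-sym g e)))

    module Bad (H : Graph) (xs : Vec (Fin N) (n H)) (emb : Embeds H h xs)
      (degs : ∀ i → deg h (lookup xs i) ≤ degree H i) (active : ∀ i → ∃ (Adj H i)) (free : ¬ Contains H g) where

      open EmbeddedComponent H h xs emb degs public

      K : List (Fin N)
      K = map ι (allFin (n H))

      ∈K : ∀ i → ι i ∈ K
      ∈K i = ∈-map⁺ ι (∈-allFin i)

      ι∉S : ∀ i → ι i ∉ S
      ι∉S i = out (hom (proj₂ (active i)))

      closed : ∀ i {t} → E g (ι i) t → t ∈ S ⊎ ∃ λ j → Adj H i j × t ≡ ι j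
      closed i e with del-or g S e
      ... | inj₁ e′ = inj₂ (closed-component i (ins⁺ (del g S) w≢x (inj₁ e′)))
      ... | inj₂ (inj₁ p) = contradiction p (ι∉S i)
      ... | inj₂ (inj₂ p) = inj₁ p

      saturated : ∀ i {t} → degree H i ≡ 3 → E g (ι i) t → t ∉ D
      saturated i {t} d e t∈ = ℕ.<⇒≱ (deg-drop (t ∷ []) ([] ∷ []) (t∈ ∷ []) (e ∷ []))
        (ℕ.≤-trans (subcubic (ι i)) (subst (_≤ deg h (ι i)) d (degree-≤ i)))

      -- `w x` is the only edge of `h` that `g` lacks, so a copy of `H` avoiding it would lie in
      -- `g`.
      fake : ∃₂ λ i j → Adj H i j × ι i ≡ w × ι j ≡ x
      fake with F.any? (λ i → F.any? λ j → T? (adj H i j) ×-dec ¬? (E? g (ι i) (ι j)))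
      ... | no none = contradiction
        (xs , proj₁ emb , λ i j a → decidable-stable (E? g (ι i) (ι j)) (λ ¬e → none (i , j , a , ¬e))) free
      ... | yes (i , j , a , ¬e) with edge-h (hom a)
      ... | inj₁ (e , _) = contradiction e ¬e
      ... | inj₂ (inj₁ (p , q)) = i , j , a , p , q
      ... | inj₂ (inj₂ (p , q)) = j , i , subst T (Graph.sym H i j) a , q , p

      module _ {i j} (ιi : ι i ≡ w) (ιj : ι j ≡ x) where

        genuine : ∀ {a b} → Adj H a b → (a ≡ i → b ≢ j) → (a ≡ j → b ≢ i) → E g (ι a) (ι b)
        genuine adj-ab ¬ij ¬ji with edge-h (hom adj-ab)
        ... | inj₁ (e , _) = e
        ... | inj₂ (inj₁ (p , q)) = contradiction (inj (trans q (≡-sym ιj))) (¬ij (inj (trans p (≡-sym ιi))))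
        ... | inj₂ (inj₂ (p , q)) = contradiction (inj (trans q (≡-sym ιi))) (¬ji (inj (trans p (≡-sym ιj))))

      pattern-edges : List (Fin N × Fin N)
      pattern-edges = map (λ (a , b) → ι a , ι b) (edges H)

      ∈-pattern : ∀ {a b} → Adj H a b → Listed pattern-edges (ι a) (ι b)
      ∈-pattern adj-ab = Sum.map (∈-map⁺ (λ (a , b) → ι a , ι b)) (∈-map⁺ (λ (a , b) → ι a , ι b)) (listed-pattern H adj-ab)

  insertion : ¬ Component K33 h → ¬ Component K4+ h → Near (2 * length B) g
  insertion ¬K33 ¬K4+ = near {δ = 2 * length B} {j = 1}
    (lift-ins w≢x uv uw vx N-u′ N-v′ w∉S x∉S w≁x (proj₁ ih-h)) ih-h
    (ν-lift-ins w≢x uv uw vx N-u′ N-v′ w∉S x∉S w≁x (proj₁ ih-h))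
    (ℕ.≤-pred (ℕ.≤-trans size-h bound)) (no-leaves h) (cost |B|≤1)
    where
    ih-h : Near 0 h
    ih-h = ih h order-h (admit subcubic-h ¬K33 ¬K4+)
    N-u′ : ∀ {t} → E g u t → t ∈ v ∷ w ∷ D
    N-u′ e with N-u e
    ... | here p = here p
    ... | there (here p) = there (here p)
    ... | there (there p) = there (there (there p))
    N-v′ : ∀ {t} → E g v t → t ∈ u ∷ x ∷ D
    N-v′ e with N-v e
    ... | here p = here p
    ... | there (here p) = there (here p)
    ... | there (there (here p)) = there (there (here p))
    bound : size h + length (path ++ incident g D) ≤ suc (size h + (5 + 3 * length B))
    bound = ℕ.≤-trans (ℕ.+-monoʳ-≤ (size h) (s≤s (s≤s (s≤s (ℕ.≤-trans (length-incident g subcubic D)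
      (ℕ.≤-reflexive (ℕ.*-suc 3 (length B)))))))) (ℕ.≤-reflexive (ℕ.+-suc (size h) (5 + 3 * length B)))
    -- 3 path edges, 3 for `y` and 3 for a vertex of `B`, minus 1 for the inserted edge.
    cost : length B ≤ 1 → 5 + 3 * length B + 0 ≤ 2 * length B + 6
    cost p with length B
    cost _ | 0 = s≤s (s≤s (s≤s (s≤s (s≤s z≤n))))
    cost _ | 1 = ℕ.≤-refl
    cost (s≤s ()) | suc (suc _)

  module _ (xs : Vec (Fin N) 6) (emb : Embeds K33 h xs) (degs : ∀ i → deg h (lookup xs i) ≤ degree K33 i) where

    private
      open Bad K33 xs emb degs K33-active (no-K33 ∘ contains⇒component-K33 {g = g} subcubic)

      S₃₃ : List (Fin N)
      S₃₃ = u ∷ v ∷ K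

      inside : ∀ a {t} → E g (ι a) t → t ≡ u ⊎ t ≡ v ⊎ ∃ λ b → Adj K33 a b × t ≡ ι b
      inside a e with closed a e
      ... | inj₂ q = inj₂ (inj₂ q)
      ... | inj₁ (here p) = inj₁ p
      ... | inj₁ (there (here p)) = inj₂ (inj₁ p)
      ... | inj₁ (there (there p)) = contradiction p (saturated a (K33-degree a) e)

      -- All neighbours of a copy vertex are `u`, `v` or in the copy, hence in `S₃₃`. Attachment is
      -- thus decided by the vertices in `fs` alone.
      later : ∀ {a fs t} → (∀ {b} → ι b ∈ fs → Adj K33 a b → E g (ι a) (ι b) → ι b ≡ t) → fs ⊆ K →
              ∀ {z} → E g (ι a) z → z ∉ S₃₃ ⊎ z ∈ fs → z ≡ t
      later {a} only fs⊆K e allowed with inside a e | allowed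
      ... | inj₁ refl | inj₁ z∉ = contradiction (here refl) z∉
      ... | inj₂ (inj₁ refl) | inj₁ z∉ = contradiction (there (here refl)) z∉
      ... | inj₂ (inj₂ (b , _ , refl)) | inj₁ z∉ = contradiction (there (there (∈K b))) z∉
      ... | inj₂ (inj₂ (b , ab , refl)) | inj₂ z∈ = only z∈ ab e
      ... | inj₁ refl | inj₂ z∈ with ∈-map⁻ ι (fs⊆K z∈)
      ... | b , _ , eq = contradiction (here (≡-sym eq)) (ι∉S b)
      later {a} only fs⊆K e allowed | inj₂ (inj₁ refl) | inj₂ z∈ with ∈-map⁻ ι (fs⊆K z∈)
      ... | b , _ , eq = contradiction (there (here (≡-sym eq))) (ι∉S b)

    module _ (P : List (Fin N × Fin N)) (∈P : ∀ {a b} → Adj K33 a b → Listed P (ι a) (ι b)) (|P| : length P ≡ 9) where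

      private
        L : List (Fin N × Fin N)
        L = P ++ (u , v) ∷ (u , w) ∷ (v , x) ∷ (v , y) ∷ map (u ,_) B

        spoke : ∀ {p} → p ∈ (u , v) ∷ (u , w) ∷ (v , x) ∷ (v , y) ∷ map (u ,_) B → p ∈ L
        spoke = ∈-++⁺ʳ P

        lost-u : ∀ {t} → E g u t → Listed L u t
        lost-u = listed-u {L} (inj₁ (spoke (here refl))) (inj₁ (spoke (there (here refl))))
          (λ q _ → inj₁ (spoke (there (there (there (there (∈-map⁺ (u ,_) q)))))))
        lost-v : ∀ {t} → E g v t → Listed L v t
        lost-v = listed-v {L} (inj₂ (spoke (here refl))) (inj₁ (spoke (there (there (here refl)))))
          (inj₁ (spoke (there (there (there (here refl))))))
        lost-from : ∀ {s t} → s ∈ S₃₃ → E g s t → Listed L s t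
        lost-from (here refl) e = lost-u e
        lost-from (there (here refl)) e = lost-v e
        lost-from (there (there p)) e with ∈-map⁻ ι p
        ... | i , _ , refl with inside i e
        ... | inj₁ refl = Sum.swap (lost-u (E-sym g e))
        ... | inj₂ (inj₁ refl) = Sum.swap (lost-v (E-sym g e))
        ... | inj₂ (inj₂ (j , ij , refl)) = Listed-mono (λ q → ∈-++⁺ˡ {xs = P} q) (∈P ij)

        lost : ∀ {a b} → E g a b → E (del g S₃₃) a b ⊎ Listed L a b
        lost e = Sum.map₂ Sum.[ (λ a∈ → lost-from a∈ e) , (λ b∈ → Sum.swap (lost-from b∈ (E-sym g e))) ]′ (del-or g S₃₃ e)

      -- The copy goes together with `u` and `v`, while `D` can stay, having no neighbour in the
      -- copy. The matching `i e`, `c j` spans a path without any edge to the rest.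
      crossing : ∀ {i j e c} → Adj K33 i j → ι i ≡ w → ι j ≡ x → Adj K33 i e → Adj K33 e c → Adj K33 c j →
                 e ≢ j → c ≢ i → ¬ Adj K33 i c → ¬ Adj K33 e j → Near (2 * length B) g
      crossing {i} {j} {e} {c} ij ιi ιj ie ec cj e≢j c≢i ¬ic ¬ej = near {δ = 2 * length B} {j = 2}
        (lift-del adjacent′ disjoint′ M⊆S attached′ (proj₁ rest)) rest
        (ν-lift-del adjacent′ disjoint′ M⊆S attached′ (proj₁ rest))
        (ℕ.≤-pred (ℕ.≤-trans (size-ins {g = g} {h = del g S₃₃} lost w≢x w≁x (inj₂ wx-listed)) (ℕ.≤-reflexive count)))
        (no-leaves (del g S₃₃)) cost
        where
        rest : Near 0 (del g S₃₃)
        rest = del-near S₃₃ (here refl) (v , uv)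
        M = (ι i , ι e) ∷ (ι c , ι j) ∷ []
        e≢i : e ≢ i
        e≢i eq = E-irr h (hom {i} {e} ie) (cong ι (≡-sym eq))
        c≢j : c ≢ j
        c≢j eq = E-irr h (hom {c} {j} cj) (cong ι eq)
        i≢j : i ≢ j
        i≢j eq = E-irr h (hom {i} {j} ij) (cong ι eq)
        c≢e : c ≢ e
        c≢e eq = E-irr h (hom {e} {c} ec) (cong ι (≡-sym eq))
        adjacent′ : All (λ p → E g (proj₁ p) (proj₂ p)) M
        adjacent′ = genuine ιi ιj ie (λ _ → e≢j) (λ p → contradiction p i≢j) ∷
                    genuine ιi ιj cj (λ p → contradiction p c≢i) (λ p → contradiction p c≢j) ∷ []
        disjoint′ : Unique (ι i ∷ ι e ∷ ι c ∷ ι j ∷ [])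
        disjoint′ = ((≢-sym e≢i ∘ inj) ∷ (≢-sym c≢i ∘ inj) ∷ (i≢j ∘ inj) ∷ []) ∷
                    ((≢-sym c≢e ∘ inj) ∷ (e≢j ∘ inj) ∷ []) ∷ ((c≢j ∘ inj) ∷ []) ∷ [] ∷ []
        in-K : ∀ {is} → map ι is ⊆ K
        in-K p with ∈-map⁻ ι p
        ... | k , _ , refl = ∈K k
        M⊆S : covered M ⊆ S₃₃
        M⊆S p = there (there (in-K {i ∷ e ∷ c ∷ j ∷ []} p))
        wx-listed : Listed L w x
        wx-listed = subst₂ (Listed L) ιi ιj (Listed-mono (λ q → ∈-++⁺ˡ {xs = P} q) (∈P ij))
        attached′ : Attached g S₃₃ (ι i ∷ ι e ∷ ι c ∷ ι j ∷ [])
        attached′ =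
          attach (ι e) (later {i} (λ
            { (here eq) _ _ → eq
            ; (there (here eq)) ib _ → contradiction (subst (Adj K33 i) (inj eq) ib) ¬ic
            ; (there (there (here eq))) _ e′ → contradiction (subst₂ (E g) ιi (trans eq ιj) e′) w≁x }) (in-K {e ∷ c ∷ j ∷ []})) (
          attach (ι c) (later {e} (λ
            { (here eq) _ _ → eq
            ; (there (here eq)) eb _ → contradiction (subst (Adj K33 e) (inj eq) eb) ¬ej }) (in-K {c ∷ j ∷ []})) (
          attach (ι j) (later {c} (λ { (here eq) _ _ → eq }) (in-K {j ∷ []})) (
          attach (ι j) (later {j} {[]} (λ ()) (λ ())) [])))
        -- 9 pattern edges, 4 edges `u v`, `u w`, `v x`, `v y`, and those from `u` to `B`. One of
        -- the 9 is the absent `w x`, so 12 + |B| remain for two matching edges.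
        length-L : length L ≡ 13 + length B
        length-L = trans (L.length-++ P) (cong₂ (λ p b → p + (4 + b)) |P| (L.length-map (u ,_) B))
        count : size (del g S₃₃) + length L ≡ suc (size (del g S₃₃) + (12 + length B))
        count = trans (cong (size (del g S₃₃) +_) length-L) (ℕ.+-suc (size (del g S₃₃)) (12 + length B))
        cost : 12 + length B + 0 ≤ 2 * length B + 12
        cost = ℕ.≤-trans (ℕ.≤-reflexive (trans (ℕ.+-identityʳ (12 + length B)) (ℕ.+-comm 12 (length B))))
          (ℕ.+-monoˡ-≤ 12 (ℕ.m≤n*m (length B) 2))

    bad-K33 : Near (2 * length B) g
    bad-K33 =
      let i , j , ij , ιi , ιj = fake
          e , c , ie , ec , cj , e≢j , c≢i , ¬ic , ¬ej = K33-bypass i j ij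
      in crossing pattern-edges ∈-pattern (L.length-map (λ (a , b) → ι a , ι b) (edges K33))
           ij ιi ιj ie ec cj e≢j c≢i ¬ic ¬ej

  module _ (xs : Vec (Fin N) 5) (emb : Embeds K4+ h xs) (degs : ∀ i → deg h (lookup xs i) ≤ degree K4+ i) where

    private
      open Bad K4+ xs emb degs K4+-active K4+-free

      -- Unlike `S₃₃` this contains `B`: here `u v` is matched, and `u` is to see nothing but `v`.
      -- The vertex `y` stays.
      S₄ : List (Fin N)
      S₄ = u ∷ v ∷ B ++ K

      B⊆S : B ⊆ S₄
      B⊆S p = there (there (∈-++⁺ˡ p))

      K⊆S : ∀ i → ι i ∈ S₄
      K⊆S i = there (there (∈-++⁺ʳ B (∈K i)))

    module _ (P : List (Fin N × Fin N)) (∈P : ∀ {a b} → Adj K4+ a b → Listed P (ι a) (ι b)) (|P| : length P ≡ 7) where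

      private
        L₁ L : List (Fin N × Fin N)
        L₁ = P ++ (u , v) ∷ (u , w) ∷ (v , x) ∷ (v , y) ∷ (ι 4F , y) ∷ []
        L = L₁ ++ incident g B

        spoke : ∀ {p} → p ∈ (u , v) ∷ (u , w) ∷ (v , x) ∷ (v , y) ∷ (ι 4F , y) ∷ [] → p ∈ L
        spoke p = ∈-++⁺ˡ {xs = L₁} (∈-++⁺ʳ P p)

        lost-B : ∀ {s t} → s ∈ B → E g s t → Listed L s t
        lost-B s∈ e = inj₁ (∈-++⁺ʳ L₁ (∈-incident g s∈ e))
        lost-u : ∀ {t} → E g u t → Listed L u t
        lost-u = listed-u {L} (inj₁ (spoke (here refl))) (inj₁ (spoke (there (here refl))))
          (λ q e → Sum.swap (lost-B q (E-sym g e)))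
        lost-v : ∀ {t} → E g v t → Listed L v t
        lost-v = listed-v {L} (inj₂ (spoke (here refl))) (inj₁ (spoke (there (there (here refl)))))
          (inj₁ (spoke (there (there (there (here refl))))))
        lost-y : ∀ i → Dec (i ≡ 4F) → E g (ι i) y → Listed L (ι i) y
        lost-y i (yes refl) _ = inj₁ (spoke (there (there (there (there (here refl))))))
        lost-y i (no i≢4) e = contradiction (here refl) (saturated i (K4+-degree i i≢4) e)
        lost-from : ∀ {s t} → s ∈ S₄ → E g s t → Listed L s t
        lost-from (here refl) e = lost-u e
        lost-from (there (here refl)) e = lost-v e
        lost-from (there (there p)) e with ∈-++⁻ B p
        ... | inj₁ s∈ = lost-B s∈ e
        ... | inj₂ s∈ with ∈-map⁻ ι s∈
        ... | i , _ , refl with closed i e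
        ... | inj₂ (j , ij , refl) = Listed-mono (λ q → ∈-++⁺ˡ {xs = L₁} (∈-++⁺ˡ q)) (∈P ij)
        ... | inj₁ (here refl) = Sum.swap (lost-u (E-sym g e))
        ... | inj₁ (there (here refl)) = Sum.swap (lost-v (E-sym g e))
        ... | inj₁ (there (there (here refl))) = lost-y i (i F.≟ 4F) e
        ... | inj₁ (there (there (there q))) = Sum.swap (lost-B q (E-sym g e))

        lost : ∀ {a b} → E g a b → E (del g S₄) a b ⊎ Listed L a b
        lost e = Sum.map₂ Sum.[ (λ a∈ → lost-from a∈ e) , (λ b∈ → Sum.swap (lost-from b∈ (E-sym g e))) ]′ (del-or g S₄ e)

      -- `u` sees only `v` and `a` sees only `b`, while `v` and `b` see at most `y` besides. So
      -- `u v` and `a b` are two pendant paths, and no cycle arises even if both hang on `y`.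
      avoiding : ∀ {i j a b} → Adj K4+ i j → ι i ≡ w → ι j ≡ x → Adj K4+ a b →
                 a ≢ 4F → a ≢ i → a ≢ j → b ≢ i → b ≢ j → Near (2 * length B) g
      avoiding {i} {j} {a} {b} ij ιi ιj ab a≢4 a≢i a≢j b≢i b≢j = near {δ = 2 * length B} {j = 2}
        (lift-del adjacent′ disjoint′ M⊆S attached′ (proj₁ rest)) rest
        (ν-lift-del adjacent′ disjoint′ M⊆S attached′ (proj₁ rest))
        (ℕ.≤-pred (ℕ.≤-trans (size-ins {g = g} {h = del g S₄} lost w≢x w≁x (inj₂ wx-listed)) count))
        (no-leaves (del g S₄)) (cost |B|≤1)
        where
        rest : Near 0 (del g S₄)
        rest = del-near S₄ (here refl) (v , uv)
        M = (u , v) ∷ (ι a , ι b) ∷ []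
        adjacent′ : All (λ p → E g (proj₁ p) (proj₂ p)) M
        adjacent′ = uv ∷ genuine ιi ιj ab (λ p → contradiction p a≢i) (λ p → contradiction p a≢j) ∷ []
        u≢ι : ∀ k → u ≢ ι k
        u≢ι k eq = ι∉S k (here (≡-sym eq))
        v≢ι : ∀ k → v ≢ ι k
        v≢ι k eq = ι∉S k (there (here (≡-sym eq)))
        D≢ι : ∀ {t} k → t ∈ D → t ≢ ι k
        D≢ι k t∈ eq = ι∉S k (there (there (subst (_∈ D) eq t∈)))
        disjoint′ : Unique (u ∷ v ∷ ι a ∷ ι b ∷ [])
        disjoint′ = (E-irr g uv ∷ u≢ι a ∷ u≢ι b ∷ []) ∷ (v≢ι a ∷ v≢ι b ∷ []) ∷
                    ((λ eq → E-irr h (hom ab) eq) ∷ []) ∷ [] ∷ []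
        M⊆S : covered M ⊆ S₄
        M⊆S (here p) = here p
        M⊆S (there (here p)) = there (here p)
        M⊆S (there (there (here refl))) = K⊆S a
        M⊆S (there (there (there (here refl)))) = K⊆S b
        wx-listed : Listed L w x
        wx-listed = subst₂ (Listed L) ιi ιj (Listed-mono (λ q → ∈-++⁺ˡ {xs = L₁} (∈-++⁺ˡ q)) (∈P ij))
        at-b : ∀ {t} → E g (ι b) t → t ∉ S₄ ⊎ t ∈ [] → t ≡ y
        at-b e (inj₁ t∉) with closed b e
        ... | inj₂ (k , _ , refl) = contradiction (K⊆S k) t∉
        ... | inj₁ (here refl) = contradiction (here refl) t∉
        ... | inj₁ (there (here refl)) = contradiction (there (here refl)) t∉
        ... | inj₁ (there (there (here eq))) = eq
        ... | inj₁ (there (there (there q))) = contradiction (B⊆S q) t∉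
        at-a : ∀ {t} → E g (ι a) t → t ∉ S₄ ⊎ t ∈ ι b ∷ [] → t ≡ ι b
        at-a e (inj₂ (here eq)) = eq
        at-a e (inj₁ t∉) with closed a e
        ... | inj₂ (k , _ , refl) = contradiction (K⊆S k) t∉
        ... | inj₁ (here refl) = contradiction (here refl) t∉
        ... | inj₁ (there (here refl)) = contradiction (there (here refl)) t∉
        ... | inj₁ (there (there q)) = contradiction q (saturated a (K4+-degree a a≢4) e)
        at-v : ∀ {t} → E g v t → t ∉ S₄ ⊎ t ∈ ι a ∷ ι b ∷ [] → t ≡ y
        at-v e allowed with N-v e | allowed
        ... | there (there (here eq)) | _ = eq
        ... | here refl | inj₁ t∉ = contradiction (here refl) t∉
        ... | here refl | inj₂ (here eq) = contradiction eq (u≢ι a)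
        ... | here refl | inj₂ (there (here eq)) = contradiction eq (u≢ι b)
        ... | there (here refl) | inj₁ t∉ = contradiction (subst (_∈ S₄) ιj (K⊆S j)) t∉
        ... | there (here refl) | inj₂ (here eq) = contradiction (≡-sym (inj (trans ιj eq))) a≢j
        ... | there (here refl) | inj₂ (there (here eq)) = contradiction (≡-sym (inj (trans ιj eq))) b≢j
        at-u : ∀ {t} → E g u t → t ∉ S₄ ⊎ t ∈ v ∷ ι a ∷ ι b ∷ [] → t ≡ v
        at-u e (inj₂ (here eq)) = eq
        at-u e allowed with N-u e | allowed
        ... | here eq | _ = eq
        ... | there (here refl) | inj₁ t∉ = contradiction (subst (_∈ S₄) ιi (K⊆S i)) t∉
        ... | there (here refl) | inj₂ (here eq) = eq
        ... | there (here refl) | inj₂ (there (here eq)) = contradiction (≡-sym (inj (trans ιi eq))) a≢i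
        ... | there (here refl) | inj₂ (there (there (here eq))) = contradiction (≡-sym (inj (trans ιi eq))) b≢i
        ... | there (there q) | inj₁ t∉ = contradiction (B⊆S q) t∉
        ... | there (there q) | inj₂ (here eq) = eq
        ... | there (there q) | inj₂ (there (here eq)) = contradiction eq (D≢ι a (there q))
        ... | there (there q) | inj₂ (there (there (here eq))) = contradiction eq (D≢ι b (there q))
        attached′ : Attached g S₄ (u ∷ v ∷ ι a ∷ ι b ∷ [])
        attached′ = attach v at-u (attach y at-v (attach (ι b) at-a (attach y at-b [])))
        -- 7 pattern edges, among them the absent `w x`, and 5 further entries; `4F` is the only
        -- copy vertex that may reach `y`. With 3 for each vertex of `B` the net loss is 11 + 3|B|,
        -- against 12 + 2|B|.
        length-L : length L ≡ 12 + length (incident g B)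
        length-L = trans (L.length-++ L₁) (cong (_+ length (incident g B)) (trans (L.length-++ P) (cong (_+ 5) |P|)))
        count : size (del g S₄) + length L ≤ suc (size (del g S₄) + (11 + 3 * length B))
        count = ℕ.≤-trans (ℕ.+-monoʳ-≤ (size (del g S₄)) (ℕ.≤-trans (ℕ.≤-reflexive length-L)
            (ℕ.+-monoʳ-≤ 12 (length-incident g subcubic B))))
          (ℕ.≤-reflexive (ℕ.+-suc (size (del g S₄)) (11 + 3 * length B)))
        cost : length B ≤ 1 → 11 + 3 * length B + 0 ≤ 2 * length B + 12
        cost p with length B
        cost _ | 0 = ℕ.n≤1+n 11
        cost _ | 1 = ℕ.≤-refl
        cost (s≤s ()) | suc (suc _)

    bad-K4+ : Near (2 * length B) g
    bad-K4+ =
      let i , j , ij , ιi , ιj = fake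
          a , b , ab , a≢4 , a≢i , a≢j , b≢i , b≢j = K4+-disjoint i j ij
      in avoiding pattern-edges ∈-pattern (L.length-map (λ (a , b) → ι a , ι b) (edges K4+))
           ij ιi ιj ab a≢4 a≢i a≢j b≢i b≢j

  -- No deficit when `u` has degree 2 and `B` is empty; deficit 2 when `B` holds the third neighbour
  -- of `u`.
  insert-edge : Near (2 * length B) g
  insert-edge = cases (component? K33 h) (component? K4+ h)
    where
    cases : Dec (Component K33 h) → Dec (Component K4+ h) → Near (2 * length B) g
    cases (yes (xs , emb , degs)) _ = bad-K33 xs emb degs
    cases (no _) (yes (xs , emb , degs)) = bad-K4+ xs emb degs
    cases (no ¬K33) (no ¬K4+) = insertion ¬K33 ¬K4+

-- Graphs without leaves: a vertex of degree 2, then cubic graphs.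

module _ {N : ℕ} (g : SimpleGraph N) where

  embedding : ∀ H {xs : Vec (Fin N) (n H)} → Vec.Unique xs →
              All (λ (i , j) → E g (lookup xs i) (lookup xs j)) (edges H) → Embeds H g xs
  embedding H u es = Vec.lookup-injective u , λ i j a →
    Sum.[ All.lookup es , E-sym g ∘ All.lookup es ]′ (listed-pattern H a)

module Leafless {N : ℕ} (g : SimpleGraph N) (adm : Admissible g) (ih : InductionHypothesis g)
                (K4+-free : ¬ Contains K4+ g) (leafless : ∀ t → ¬ Leaf g t) where

  open Admissible adm
  open Deletions g adm ih K4+-free
  open Insertion g adm ih K4+-free leafless using (insert-edge)

  no-leaf : ∀ {k} {ι : Fin k → Fin N} j → Leaf g (ι j) → ι j ∈ []
  no-leaf {ι = ι} j leaf = contradiction leaf (leafless (ι j))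

  -- Deleting `x` cuts `v` off, so `u v` hangs on `w` alone, at a cost of at most 5.
  path-step : ∀ {u v w x} → Star g u (v ∷ w ∷ []) → Star g v (u ∷ x ∷ []) → Near 0 g
  path-step {u} {v} {w} {x} (N-u@(nbhd (uv ∷ _) _) , _) (N-v@(nbhd (_ ∷ vx ∷ []) _) , (u≢x ∷ []) ∷ _)
    with around₁ g subcubic (E-sym g vx)
  ... | x₁ , x₂ , N-x = reduce 0
    ((0F , 1F ∷ 3F ∷ []) ∷ (1F , 0F ∷ 2F ∷ []) ∷ (2F , 1F ∷ 4F ∷ 5F ∷ []) ∷ []) ((1F , 0F) ∷ [])
    (N-u ∷ N-v ∷ N-x ∷ []) ((E-irr g uv ∷ u≢x ∷ []) ∷ (E-irr g vx ∷ []) ∷ [] ∷ []) [] no-leaf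
    (del-near _ (here refl) (v , uv))
    where open Configuration g (lookup (u ∷ v ∷ x ∷ w ∷ x₁ ∷ x₂ ∷ []))

  -- Deleting `w` removes both of its edges into `u v`, which then hangs on `y` alone, at a cost of
  -- at most 5.
  triangle-step : ∀ {u v w y} → Star g u (v ∷ w ∷ []) → Star g v (u ∷ w ∷ y ∷ []) → Near 0 g
  triangle-step {u} {v} {w} {y} (N-u@(nbhd (uv ∷ uw ∷ []) _) , _) (N-v@(nbhd (_ ∷ vw ∷ _ ∷ []) _) , _)
    with around₂ g subcubic (E-sym g uw) (E-sym g vw) (E-irr g uv)
  ... | q , N-w = reduce 0
    ((0F , 1F ∷ 2F ∷ []) ∷ (1F , 0F ∷ 2F ∷ 3F ∷ []) ∷ (2F , 0F ∷ 1F ∷ 4F ∷ []) ∷ []) ((0F , 1F) ∷ [])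
    (N-u ∷ N-v ∷ N-w ∷ []) ((E-irr g uv ∷ E-irr g uw ∷ []) ∷ (E-irr g vw ∷ []) ∷ [] ∷ []) [] no-leaf
    (del-near _ (here refl) (v , uv))
    where open Configuration g (lookup (u ∷ v ∷ w ∷ y ∷ q ∷ []))

  -- K_{2,3} with parts {v , w} and {u , x , y}.
  module Theta {u v w x y} (star-u : Star g u (v ∷ w ∷ [])) (star-v : Star g v (u ∷ x ∷ y ∷ []))
               (star-w : Star g w (u ∷ x ∷ y ∷ [])) where

    private
      N-u : Neighbours g u (v ∷ w ∷ [])
      N-u = proj₁ star-u
      N-v : Neighbours g v (u ∷ x ∷ y ∷ [])
      N-v = proj₁ star-v
      N-w : Neighbours g w (u ∷ x ∷ y ∷ [])
      N-w = proj₁ star-w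

      uv : E g u v
      uv = All.lookup (sound N-u) (here refl)
      uw : E g u w
      uw = All.lookup (sound N-u) (there (here refl))
      vx : E g v x
      vx = All.lookup (sound N-v) (there (here refl))
      vy : E g v y
      vy = All.lookup (sound N-v) (there (there (here refl)))
      wx : E g w x
      wx = All.lookup (sound N-w) (there (here refl))
      wy : E g w y
      wy = All.lookup (sound N-w) (there (there (here refl)))

      second : ∀ {a b : Fin N} {cs} → Unique (a ∷ b ∷ cs) → a ≢ b
      second ((a≢b ∷ _) ∷ _) = a≢b
      third : ∀ {a b c : Fin N} {cs} → Unique (a ∷ b ∷ c ∷ cs) → a ≢ c × b ≢ c
      third ((_ ∷ a≢c ∷ _) ∷ (b≢c ∷ _) ∷ _) = a≢c , b≢c

      u≢v : u ≢ v
      u≢v = E-irr g uv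
      u≢w : u ≢ w
      u≢w = E-irr g uw
      v≢w : v ≢ w
      v≢w = second (proj₂ star-u)
      u≢x : u ≢ x
      u≢x = second (proj₂ star-v)
      u≢y : u ≢ y
      u≢y = proj₁ (third (proj₂ star-v))
      x≢y : x ≢ y
      x≢y = proj₂ (third (proj₂ star-v))
      v≢x : v ≢ x
      v≢x = E-irr g vx
      v≢y : v ≢ y
      v≢y = E-irr g vy
      w≢x : w ≢ x
      w≢x = E-irr g wx
      w≢y : w ≢ y
      w≢y = E-irr g wy

    -- With `x y` the vertices `v`, `w`, `x`, `y` would form a `K4` whose edge `v w` is subdivided
    -- by `u`.
    x≁y : ¬ E g x y
    x≁y xy = K4+-free (v ∷ w ∷ x ∷ y ∷ u ∷ [] , embedding g K4+ {xs = v ∷ w ∷ x ∷ y ∷ u ∷ []}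
      ((v≢w ∷ᵛ v≢x ∷ᵛ v≢y ∷ᵛ ≢-sym u≢v ∷ᵛ []ᵛ) ∷
        (w≢x ∷ᵛ w≢y ∷ᵛ ≢-sym u≢w ∷ᵛ []ᵛ) ∷ (x≢y ∷ᵛ ≢-sym u≢x ∷ᵛ []ᵛ) ∷
        (≢-sym u≢y ∷ᵛ []ᵛ) ∷ []ᵛ ∷ [])
      (vx ∷ vy ∷ E-sym g uv ∷ wx ∷ wy ∷ E-sym g uw ∷ xy ∷ []))

    closed-x : Neighbours g x (v ∷ w ∷ []) → Near 0 g
    closed-x N-x = reduce 0
      ((0F , 1F ∷ 2F ∷ []) ∷ (1F , 0F ∷ 3F ∷ 4F ∷ []) ∷ (2F , 0F ∷ 3F ∷ 4F ∷ []) ∷ (3F , 1F ∷ 2F ∷ []) ∷ [])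
      ((0F , 1F) ∷ [])
      (N-u ∷ N-v ∷ N-w ∷ N-x ∷ [])
      ((u≢v ∷ u≢w ∷ u≢x ∷ []) ∷ (v≢w ∷ v≢x ∷ []) ∷ (w≢x ∷ []) ∷ [] ∷ []) [] no-leaf
      (del-near _ (here refl) (v , uv))
      where open Configuration g (lookup (u ∷ v ∷ w ∷ x ∷ y ∷ []))

    module _ {z} (star-x : Star g x (v ∷ w ∷ z ∷ [])) where

      private
        N-x : Neighbours g x (v ∷ w ∷ z ∷ [])
        N-x = proj₁ star-x
        xz : E g x z
        xz = All.lookup (sound N-x) (there (there (here refl)))
        v≢z : v ≢ z
        v≢z = proj₁ (third (proj₂ star-x))
        w≢z : w ≢ z
        w≢z = proj₂ (third (proj₂ star-x))
        x≢z : x ≢ z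
        x≢z = E-irr g xz
        u≢z : u ≢ z
        u≢z refl with full N-u (E-sym g xz)
        ... | here eq = v≢x (≡-sym eq)
        ... | there (here eq) = w≢x (≡-sym eq)
        y≢z : y ≢ z
        y≢z refl = x≁y xz

      -- With `w` and `y` deleted, `u v x z` is an induced path hanging on `t`: at most 9 edges
      -- against 12.
      merged : E g y z → Near 0 g
      merged yz with around₂ g subcubic (E-sym g xz) (E-sym g yz) x≢y
      ... | t , N-z = reduce 0
        ((0F , 1F ∷ 2F ∷ []) ∷ (1F , 0F ∷ 3F ∷ 4F ∷ []) ∷ (2F , 0F ∷ 3F ∷ 4F ∷ []) ∷ (3F , 1F ∷ 2F ∷ 5F ∷ []) ∷
         (4F , 1F ∷ 2F ∷ 5F ∷ []) ∷ (5F , 3F ∷ 4F ∷ 6F ∷ []) ∷ []) ((0F , 1F) ∷ (3F , 5F) ∷ [])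
        (N-u ∷ N-v ∷ N-w ∷ N-x ∷ proj₁ (around₃ g subcubic (E-sym g vy) (E-sym g wy) yz v≢w v≢z w≢z) ∷ N-z ∷ [])
        ((u≢v ∷ u≢w ∷ u≢x ∷ u≢y ∷ u≢z ∷ []) ∷ (v≢w ∷ v≢x ∷ v≢y ∷ v≢z ∷ []) ∷ (w≢x ∷ w≢y ∷ w≢z ∷ []) ∷
         (x≢y ∷ x≢z ∷ []) ∷ (y≢z ∷ []) ∷ [] ∷ []) [] no-leaf
        (del-near _ (here refl) (v , uv))
        where open Configuration g (lookup (u ∷ v ∷ w ∷ x ∷ y ∷ z ∷ t ∷ []))

      -- The path `u v x z` again, but `z` may have two neighbours beyond it. Deleting `s` leaves
      -- `t` alone and brings the count to exactly 12.
      spread : ∀ {s t} → ¬ E g y z → Neighbours g z (x ∷ s ∷ t ∷ []) → x ≢ s → Near 0 g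
      spread {s} {t} y≁z N-z x≢s with around₂ g subcubic (E-sym g vy) (E-sym g wy) v≢w | around₁ g subcubic (E-sym g zs)
        where
        zs : E g z s
        zs = All.lookup (sound N-z) (there (here refl))
      ... | y′ , N-y | s₁ , s₂ , N-s = reduce 0
        ((0F , 1F ∷ 2F ∷ []) ∷ (1F , 0F ∷ 3F ∷ 4F ∷ []) ∷ (2F , 0F ∷ 3F ∷ 4F ∷ []) ∷ (3F , 1F ∷ 2F ∷ 5F ∷ []) ∷
         (4F , 1F ∷ 2F ∷ 7F ∷ []) ∷ (5F , 3F ∷ 6F ∷ 8F ∷ []) ∷ (6F , 5F ∷ 9F ∷ Fin.suc 9F ∷ []) ∷ [])
        ((0F , 1F) ∷ (3F , 5F) ∷ [])
        (N-u ∷ N-v ∷ N-w ∷ N-x ∷ N-y ∷ N-z ∷ N-s ∷ [])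
        ((u≢v ∷ u≢w ∷ u≢x ∷ u≢y ∷ u≢z ∷ u≢s ∷ []) ∷ (v≢w ∷ v≢x ∷ v≢y ∷ v≢z ∷ v≢s ∷ []) ∷
         (w≢x ∷ w≢y ∷ w≢z ∷ w≢s ∷ []) ∷ (x≢y ∷ x≢z ∷ x≢s ∷ []) ∷ (y≢z ∷ y≢s ∷ []) ∷ (E-irr g zs ∷ []) ∷ [] ∷ [])
        [] no-leaf (del-near _ (here refl) (v , uv))
        where
        open Configuration g (lookup (u ∷ v ∷ w ∷ x ∷ y ∷ z ∷ s ∷ y′ ∷ t ∷ s₁ ∷ s₂ ∷ []))
        zs : E g z s
        zs = All.lookup (sound N-z) (there (here refl))
        u≢s : u ≢ s
        u≢s refl with full N-u (E-sym g zs)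
        ... | here eq = v≢z (≡-sym eq)
        ... | there (here eq) = w≢z (≡-sym eq)
        z∉ : z ∉ u ∷ x ∷ y ∷ []
        z∉ (here eq) = u≢z (≡-sym eq)
        z∉ (there (here eq)) = x≢z (≡-sym eq)
        z∉ (there (there (here eq))) = y≢z (≡-sym eq)
        v≢s : v ≢ s
        v≢s refl = z∉ (full N-v (E-sym g zs))
        w≢s : w ≢ s
        w≢s refl = z∉ (full N-w (E-sym g zs))
        y≢s : y ≢ s
        y≢s refl = y≁z (E-sym g zs)

      open-x : Near 0 g
      open-x = cases (E? g y z) (star₁ g subcubic (E-sym g xz))
        where
        cases : Dec (E g y z) → Star₁ g subcubic z x → Near 0 g
        cases (yes yz) _ = merged yz
        cases (no y≁z) (one st) = contradiction (star-deg g st) (leafless z)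
        cases (no y≁z) (two s (nbhd (p ∷ q ∷ []) f , (x≢s ∷ []) ∷ _)) =
          spread y≁z (nbhd (p ∷ q ∷ q ∷ []) (∈-++⁺ˡ ∘ f)) x≢s
        cases (no y≁z) (three s t (N-z , (x≢s ∷ _) ∷ _)) = spread y≁z N-z x≢s

    theta-step : Near 0 g
    theta-step = cases (star₂ g subcubic (E-sym g vx) (E-sym g wx) v≢w)
      where
      cases : Star₂ g subcubic x v w → Near 0 g
      cases (two (N-x , _)) = closed-x N-x
      cases (three _ st) = open-x st

  module TwoStep {u v w} (star-u : Star g u (v ∷ w ∷ [])) where

    private
      N-u : ∀ {t} → E g u t → t ∈ v ∷ w ∷ []
      N-u = full (proj₁ star-u)
      uv : E g u v
      uv = All.lookup (sound (proj₁ star-u)) (here refl)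
      uw : E g u w
      uw = All.lookup (sound (proj₁ star-u)) (there (here refl))

    insert-wx : ∀ {x y} → Star g v (u ∷ x ∷ y ∷ []) → w ≢ x → w ≢ y → ¬ E g w x → Near 0 g
    insert-wx {x} {y} (N-v@(nbhd (_ ∷ vx ∷ vy ∷ []) _) , (u≢x ∷ u≢y ∷ []) ∷ (x≢y ∷ []) ∷ _) w≢x w≢y w≁x =
      insert-edge [] z≤n uv uw N-u N-v
        (λ { (here eq) → u≢y eq }) (λ { (here eq) → E-irr g vy eq })
        (λ { (here eq) → E-irr g uw (≡-sym eq) ; (there (here eq)) → second (proj₂ star-u) (≡-sym eq)
           ; (there (there (here eq))) → w≢y eq })
        (λ { (here eq) → u≢x (≡-sym eq) ; (there (here eq)) → E-irr g vx (≡-sym eq)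
           ; (there (there (here eq))) → x≢y eq })
        w≢x w≁x
      where
      second : ∀ {a b : Fin N} {cs} → Unique (a ∷ b ∷ cs) → a ≢ b
      second ((a≢b ∷ _) ∷ _) = a≢b

    two-step : Near 0 g
    two-step with star₁ g subcubic (E-sym g uv)
    ... | one st = contradiction (star-deg g st) (leafless v)
    ... | two x st = path-step star-u st
    ... | three x y st@(_ , (u≢x ∷ u≢y ∷ []) ∷ (x≢y ∷ []) ∷ _) = cases (w F.≟ x) (w F.≟ y) (E? g w x) (E? g w y)
      where
      cases : Dec (w ≡ x) → Dec (w ≡ y) → Dec (E g w x) → Dec (E g w y) → Near 0 g
      cases (yes refl) _ _ _ = triangle-step star-u st
      cases (no _) (yes refl) _ _ = triangle-step star-u (swap-star st)
      cases (no w≢x) (no w≢y) (no w≁x) _ = insert-wx st w≢x w≢y w≁x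
      cases (no w≢x) (no w≢y) (yes _) (no w≁y) = insert-wx (swap-star st) w≢y w≢x w≁y
      cases (no _) (no _) (yes wx) (yes wy) = Theta.theta-step star-u st
        (around₃ g subcubic (E-sym g uw) wx wy u≢x u≢y x≢y)

  -- Deleting `b` and `x` leaves `u v` hanging on `a`. Since `b` serves both ends, the cost is 8,
  -- within the deficit of 2.
  shared-neighbour : ∀ {u v a b x} → Star g u (v ∷ a ∷ b ∷ []) → Star g v (u ∷ b ∷ x ∷ []) → Near 2 g
  shared-neighbour {u} {v} {a} {b} {x} (N-u@(nbhd (uv ∷ _ ∷ ub ∷ []) _) , _)
    (N-v@(nbhd (_ ∷ vb ∷ vx ∷ []) _) , (_ ∷ u≢x ∷ []) ∷ (b≢x ∷ []) ∷ _)
    with around₂ g subcubic (E-sym g ub) (E-sym g vb) (E-irr g uv) | around₁ g subcubic (E-sym g vx)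
  ... | b′ , N-b | x₁ , x₂ , N-x = reduce 2
    ((0F , 1F ∷ 2F ∷ 3F ∷ []) ∷ (1F , 0F ∷ 3F ∷ 4F ∷ []) ∷ (3F , 0F ∷ 1F ∷ 5F ∷ []) ∷ (4F , 1F ∷ 6F ∷ 7F ∷ []) ∷ [])
    ((1F , 0F) ∷ [])
    (N-u ∷ N-v ∷ N-b ∷ N-x ∷ [])
    ((E-irr g uv ∷ E-irr g ub ∷ u≢x ∷ []) ∷ (E-irr g vb ∷ E-irr g vx ∷ []) ∷ (b≢x ∷ []) ∷ [] ∷ []) [] no-leaf
    (del-near _ (here refl) (v , uv))
    where open Configuration g (lookup (u ∷ v ∷ a ∷ b ∷ x ∷ b′ ∷ x₁ ∷ x₂ ∷ []))

  module _ {u v : Fin N} where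

    private
      insert-ax : ∀ {a b x y} → Star g u (v ∷ a ∷ b ∷ []) → Star g v (u ∷ x ∷ y ∷ []) →
                  ¬ E g v a → ¬ E g v b → ¬ E g a x → Near 2 g
      insert-ax {a} {b} {x} {y}
        (nbhd (uv ∷ ua ∷ ub ∷ []) f , (v≢a ∷ v≢b ∷ []) ∷ (a≢b ∷ []) ∷ _)
        (N-v@(nbhd (_ ∷ vx ∷ vy ∷ []) _) , (u≢x ∷ u≢y ∷ []) ∷ (x≢y ∷ []) ∷ _) v≁a v≁b a≁x =
        insert-edge (b ∷ []) (s≤s z≤n) uv ua f N-v
          (λ { (here eq) → u≢y eq ; (there (here eq)) → E-irr g ub eq })
          (λ { (here eq) → E-irr g vy eq ; (there (here eq)) → v≢b eq })
          (λ { (here eq) → E-irr g ua (≡-sym eq) ; (there (here eq)) → v≢a (≡-sym eq)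
             ; (there (there (here refl))) → v≁a vy ; (there (there (there (here eq)))) → a≢b eq })
          (λ { (here eq) → u≢x (≡-sym eq) ; (there (here eq)) → E-irr g vx (≡-sym eq)
             ; (there (there (here eq))) → x≢y eq ; (there (there (there (here refl)))) → v≁b vx })
          (λ { refl → v≁a vx }) a≁x

    complete : ∀ {a b x y} → Star g u (v ∷ a ∷ b ∷ []) → Star g v (u ∷ x ∷ y ∷ []) →
               E g a x → E g a y → E g b x → E g b y → Contains K33 g
    complete {a} {b} {x} {y}
      (nbhd (uv ∷ ua ∷ ub ∷ []) f , (v≢a ∷ v≢b ∷ []) ∷ (a≢b ∷ []) ∷ _)
      (N-v@(nbhd (_ ∷ vx ∷ vy ∷ []) _) , (u≢x ∷ u≢y ∷ []) ∷ (x≢y ∷ []) ∷ _) ax ay bx by =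
      u ∷ x ∷ y ∷ v ∷ a ∷ b ∷ [] , embedding g K33 {xs = u ∷ x ∷ y ∷ v ∷ a ∷ b ∷ []}
        ((u≢x ∷ᵛ u≢y ∷ᵛ E-irr g uv ∷ᵛ E-irr g ua ∷ᵛ E-irr g ub ∷ᵛ []ᵛ) ∷
          (x≢y ∷ᵛ ≢-sym (E-irr g vx) ∷ᵛ ≢-sym (E-irr g ax) ∷ᵛ ≢-sym (E-irr g bx) ∷ᵛ []ᵛ) ∷
          (≢-sym (E-irr g vy) ∷ᵛ ≢-sym (E-irr g ay) ∷ᵛ ≢-sym (E-irr g by) ∷ᵛ []ᵛ) ∷
          (v≢a ∷ᵛ v≢b ∷ᵛ []ᵛ) ∷ (a≢b ∷ᵛ []ᵛ) ∷ []ᵛ ∷ [])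
        (uv ∷ ua ∷ ub ∷ E-sym g vx ∷ E-sym g ax ∷ E-sym g bx ∷ E-sym g vy ∷ E-sym g ay ∷ E-sym g by ∷ [])

    -- Four choices of the edge to insert are available; if all four are already present, the six
    -- vertices form a `K33`.
    disjoint-neighbours : ∀ {a b x y} → Star g u (v ∷ a ∷ b ∷ []) → Star g v (u ∷ x ∷ y ∷ []) →
                          ¬ E g v a → ¬ E g v b → Near 2 g
    disjoint-neighbours {a} {b} {x} {y} su sv v≁a v≁b = cases (E? g a x) (E? g a y) (E? g b x) (E? g b y)
      where
      cases : Dec (E g a x) → Dec (E g a y) → Dec (E g b x) → Dec (E g b y) → Near 2 g
      cases (no a≁x) _ _ _ = insert-ax su sv v≁a v≁b a≁x
      cases (yes _) (no a≁y) _ _ = insert-ax su (swap-star sv) v≁a v≁b a≁y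
      cases (yes _) (yes _) (no b≁x) _ = insert-ax (swap-star su) sv v≁b v≁a b≁x
      cases (yes _) (yes _) (yes _) (no b≁y) = insert-ax (swap-star su) (swap-star sv) v≁b v≁a b≁y
      cases (yes ax) (yes ay) (yes bx) (yes by) =
        contradiction (contains⇒component-K33 {g = g} subcubic (complete su sv ax ay bx by)) no-K33

    cubic-step : ∀ {a b x y} → Star g u (v ∷ a ∷ b ∷ []) → Star g v (u ∷ x ∷ y ∷ []) → Near 2 g
    cubic-step {a} {b} {x} {y} su@(nbhd (uv ∷ ua ∷ ub ∷ []) _ , _) sv = cases (E? g v a) (E? g v b)
      where
      neighbour : ∀ {c} → E g u c → E g v c → ∃ λ z → Star g v (u ∷ c ∷ z ∷ [])
      neighbour uc vc = third (pull₂ g sv vc (E-irr g uc))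
        where
        third : (∃ λ cs → Star g v (u ∷ _ ∷ cs)) → ∃ λ z → Star g v (u ∷ _ ∷ z ∷ [])
        third (z ∷ [] , st) = z , st
        third ([] , st) = contradiction (trans (≡-sym (star-deg g st)) (star-deg g sv)) λ ()
        third (_ ∷ _ ∷ _ , st) = contradiction (trans (≡-sym (star-deg g st)) (star-deg g sv)) λ ()
      cases : Dec (E g v a) → Dec (E g v b) → Near 2 g
      cases _ (yes vb) = shared-neighbour su (proj₂ (neighbour ub vb))
      cases (yes va) (no _) = shared-neighbour (swap-star su) (proj₂ (neighbour ua va))
      cases (no v≁a) (no v≁b) = disjoint-neighbours su sv v≁a v≁b

-- No walk leaves a component, so in a connected graph the copy reaches every vertex from the image
-- of `base`.
component⇒≅ : ∀ {N} (g : SimpleGraph N) (H : Graph) → Fin (n H) → Connected ⟦ g ⟧ → Component H g → ⟦ g ⟧ ≅ H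
component⇒≅ {N} g H base connected (xs , emb , degs) = record
  { to = proj₁ ∘ position
  ; from = ι
  ; from-to = λ v → ≡-sym (proj₂ (position v))
  ; to-from = λ i → inj (≡-sym (proj₂ (position (ι i))))
  ; pres = λ a b → trans (same-edge (proj₁ (position a)) (proj₁ (position b)))
                         (cong₂ (edge g) (≡-sym (proj₂ (position a))) (≡-sym (proj₂ (position b))))
  }
  where
  open EmbeddedComponent H g xs emb degs
  open SimpleGraph using (edge)

  along : ∀ {a b} → Walk ⟦ g ⟧ a b → (∃ λ i → a ≡ ι i) → ∃ λ j → b ≡ ι j
  along here p = p
  along (step e walk) (i , refl) with closed-component i e
  ... | j , _ , eq = along walk (j , eq)

  position : ∀ v → ∃ λ i → v ≡ ι i
  position v = along (connected (ι base) v) (base , refl)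

  T-ext : ∀ {p q} → (T p → T q) → (T q → T p) → p ≡ q
  T-ext {false} {false} _ _ = refl
  T-ext {true} {true} _ _ = refl
  T-ext {false} {true} _ b = contradiction _ b
  T-ext {true} {false} f _ = contradiction _ f

  same-edge : ∀ i j → adj H i j ≡ edge g (ι i) (ι j)
  same-edge i j = T-ext hom back
    where
    back : E g (ι i) (ι j) → Adj H i j
    back e with closed-component i e
    ... | k , ik , eq = subst (Adj H i) (≡-sym (inj eq)) ik

-- The induction.

module _ {N : ℕ} where

  edgeless : (g : SimpleGraph N) → ¬ ∃ (Active g) → Near 0 g
  edgeless g none = empty , ℕ.≤-reflexive (cong₂ _+_ no-edges (leafCount-0 g no-leaf))
    where
    no-leaf : ∀ t → ¬ Leaf g t
    no-leaf t leaf = none (t , deg⇒active g leaf)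
    no-edges : size g ≡ 0
    no-edges = ℕ.n≤0⇒n≡0 (length-⊆ {ys = []} (edges-unique g)
      λ {p} p∈ → contradiction (proj₁ p , proj₂ p , proj₂ (∈-edges⁻ g p∈)) none)
    empty : Solution g
    empty = record { matching = [] ; elimination = [] ; adjacent = [] ; disjoint = []
                   ; covered⊆ = λ () ; ⊆covered = λ () ; forest = [] }

  -- In a cubic graph 3 ∣ m, so a deficit of 2 is impossible.
  round : (g : SimpleGraph N) → 3 ∣ size g → (∀ t → ¬ Leaf g t) → Near 2 g → Near 0 g
  round g (divides q eq) leafless (s , s≤) = s , (begin
    size g + leafCount g  ≡⟨ cong (size g +_) (leafCount-0 g leafless) ⟩
    size g + 0            ≡⟨ ℕ.+-identityʳ (size g) ⟩
    size g                ≡⟨ eq ⟩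
    q * 3                 ≤⟨ ℕ.*-monoˡ-≤ 3 (ℕ.≤-pred (ℕ.*-cancelʳ-< 3 q (suc (2 * ν s)) q<2ν+1)) ⟩
    2 * ν s * 3           ≡⟨ six (ν s) ⟩
    6 * ν s               ∎)
    where
    open ℕ.≤-Reasoning
    six : ∀ k → 2 * k * 3 ≡ 6 * k
    six k = trans (ℕ.*-comm (2 * k) 3) (≡-sym (ℕ.*-assoc 3 2 k))
    q<2ν+1 : q * 3 < suc (2 * ν s) * 3
    q<2ν+1 = begin
      suc (q * 3)                 ≡⟨ cong suc eq ⟨
      suc (size g)                ≤⟨ s≤s (ℕ.m≤m+n (size g) (leafCount g)) ⟩
      suc (size g + leafCount g)  ≤⟨ s≤s s≤ ⟩
      3 + 6 * ν s                 ≡⟨ cong (3 +_) (six (ν s)) ⟨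
      3 + 2 * ν s * 3             ∎

  module _ (g : SimpleGraph N) (adm : Admissible g) (ih : InductionHypothesis g) where

    open Admissible adm

    private
      module _ (K4+-free : ¬ Contains K4+ g) where

        with-leaf : ∃ (Leaf g) → Near 0 g
        with-leaf (u , leaf) = leaf-step leaf (proj₂ (deg⇒active g leaf))
          where
          open Deletions.LeafStep g adm ih K4+-free

        module _ (leafless : ∀ t → ¬ Leaf g t) where

          open Leafless g adm ih K4+-free leafless

          with-two : ∀ {u v} → deg g u ≡ 2 → E g u v → Near 0 g
          with-two d e with star₁ g subcubic e
          ... | one st = contradiction (trans (≡-sym (star-deg g st)) d) λ ()
          ... | two _ st = TwoStep.two-step st
          ... | three _ _ st = contradiction (trans (≡-sym (star-deg g st)) d) λ ()

          module _ (no-two : ∀ t → deg g t ≢ 2) where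

            zero-or-three : ∀ t → deg g t ≡ 0 ⊎ deg g t ≡ 3
            zero-or-three t with deg g t | subcubic t | leafless t | no-two t
            ... | 0 | _ | _ | _ = inj₁ refl
            ... | 1 | _ | ¬1 | _ = contradiction refl ¬1
            ... | 2 | _ | _ | ¬2 = contradiction refl ¬2
            ... | 3 | _ | _ | _ = inj₂ refl
            ... | suc (suc (suc (suc _))) | s≤s (s≤s (s≤s ())) | _ | _

            three-star : ∀ {u v} → E g u v → ∃₂ λ a b → Star g u (v ∷ a ∷ b ∷ [])
            three-star {u} e with star₁ g subcubic e
            ... | one st = contradiction (star-deg g st) (leafless u)
            ... | two _ st = contradiction (star-deg g st) (no-two u)
            ... | three a b st = a , b , st

            cubic : ∃ (Active g) → Near 0 g
            cubic (u , v , e) = round g (3∣size g zero-or-three) leafless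
              (cubic-step (proj₂ (proj₂ (three-star e))) (proj₂ (proj₂ (three-star (E-sym g e)))))

    -- The order of the cases matters. Freedom from `K4+` keeps deletions admissible, and absence of
    -- leaves means that insertion can lose none. A vertex of degree 2 is handled without deficit,
    -- and only when there is none does 3 ∣ m make the deficit of 2 harmless.
    induction-step : Near 0 g
    induction-step = pattern-case (contains? K4+ g)
      where
      last-case : ∀ free leafless → (∀ t → deg g t ≢ 2) → Dec (∃ (Active g)) → Near 0 g
      last-case free leafless no-two (yes act) = cubic free leafless no-two act
      last-case free leafless no-two (no none) = edgeless g none
      two-case : ∀ (free : ¬ Contains K4+ g) (leafless : ∀ t → ¬ Leaf g t) → Dec (∃ λ t → deg g t ≡ 2) → Near 0 g
      two-case free leafless (yes (u , d)) = with-two free leafless d (proj₂ (deg⇒active g d))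
      two-case free leafless (no none) = last-case free leafless (λ t d → none (t , d)) (F.any? (Active? g))
      leaf-case : ¬ Contains K4+ g → Dec (∃ (Leaf g)) → Near 0 g
      leaf-case free (yes leaf) = with-leaf free leaf
      leaf-case free (no none) = two-case free (λ t leaf → none (t , leaf)) (F.any? λ t → deg g t ℕ.≟ 2)
      pattern-case : Dec (Contains K4+ g) → Near 0 g
      pattern-case (yes (xs , emb)) = Pendant.pendant g adm ih xs emb
      pattern-case (no free) = leaf-case free (F.any? (Leaf? g))

  admissible⇒near : (g : SimpleGraph N) → Admissible g → Near 0 g
  admissible⇒near g = <-rec (λ k → (g : SimpleGraph N) → order g ≡ k → Admissible g → Near 0 g)
    (λ { _ rec g refl adm → induction-step g adm λ h h<g → rec h<g h refl }) (order g) g refl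

theorem1 : (G : Graph) → Connected G → Subcubic G → ¬ (G ≅ K4+) → ¬ (G ≅ K33) →
    ∃ λ M → IsAcyclicMatching G M × m G ≤ 6 * length M
theorem1 G connected subcubic ¬K4+ ¬K33 = conclude (admissible⇒near g (admit subcubic
    (¬K33 ∘ component⇒≅ g K33 0F connected) (¬K4+ ∘ component⇒≅ g K4+ 0F connected)))
  where
  g : SimpleGraph (n G)
  g = record { edge = adj G ; edge-sym = Graph.sym G ; edge-irr = irr G }
  conclude : Near 0 g → ∃ λ M → IsAcyclicMatching G M × m G ≤ 6 * length M
  conclude (s , s≤) = matching s , solution⇒matching s , ℕ.≤-trans (ℕ.m≤m+n (m G) (leafCount g)) s≤
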